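{- Concept satisfiability (and hence concept subsumption) is undecidable for the description logic $\mathcal{ALC\bar N}(\circ,{}^-)$, and also for the description logic $\mathcal{ALCQ}(\circ,{}^-)$.
   Context: An interpretation $\mathcal I=(\Delta^{\mathcal I},\cdot^{\mathcal I})$ consists of a non-empty domain and a map sending each concept name $A$ to $A^{\mathcal I}\subseteq\Delta^{\mathcal I}$ and each role name $P$ to $P^{\mathcal I}\subseteq\Delta^{\mathcal I}\times\Delta^{\mathcal I}$. Role expressions are built from role names by inversion $R^-$ (with $(R^-)^{\mathcal I}=\{(j,i):(i,j)\in R^{\mathcal I}\}$) and composition $R\circ S$ (with $(R\circ S)^{\mathcal I}=\{(i,j):\exists k\,(i,k)\in R^{\mathcal I},(k,j)\in S^{\mathcal I}\}$). Concepts of $\mathcal{ALC\bar N}(\circ,{}^-)$ are built from concept names, $\top$ and $\bot$ using $\neg C$, $C\sqcap D$, $C\sqcup D$, $\forall R.C$, $\exists R.C$, $(\geq n\,R)$ and $(\leq n\,R)$, where $R$ is any role expression and $n\ge 0$ is an integer. The semantics is the standard one: - $(\forall R.C)^{\mathcal I}=\{i:\forall j\,((i,j)\in R^{\mathcal I}\Rightarrow j\in C^{\mathcal I})\}$; - $(\exists R.C)^{\mathcal I}=\{i:\exists j\,((i,j)\in R^{\mathcal I}\wedge j\in C^{\mathcal I})\}$; - $(\geq n\,R)^{\mathcal I}=\{i:\#\{j:(i,j)\in R^{\mathcal I}\}\ge n\}$, and similarly for $\leq$. $\mathcal{ALCQ}(\circ,{}^-)$ additionally allows qualified number restrictions $(\geq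 n\,R.C)$ and $(\leq n\,R.C)$, interpreted as $\{i:\#\{j:(i,j)\in R^{\mathcal I}, j\in C^{\mathcal I}\}\ge n\}$ (respectively $\le n$). A concept $C$ is satisfiable iff $C^{\mathcal I}\neq\emptyset$ for some interpretation $\mathcal I$. A concept $C$ is subsumed by $D$ iff $C^{\mathcal I}\subseteq D^{\mathcal I}$ for all interpretations $\mathcal I$. -}

module Defs where

open import Data.Nat using (ℕ; zero; suc; _+_; _*_; _<_)
open import Data.Fin using (Fin)
open import Data.Vec using (Vec; []; _∷_; lookup)
open import Data.Product using (Σ; _×_; _,_)
open import Data.Sum using (_⊎_)
open import Data.Empty using (⊥)
open import Data.Unit using (⊤)
open import Level using (Level; _⊔_) renaming (suc to lsuc; zero to lzero)
open import Relation.Nullary using (¬_)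
open import Relation.Binary.PropositionalEquality using (_≡_)

data RoleExpr : Set where
  name : ℕ → RoleExpr
  inv  : RoleExpr → RoleExpr
  comp : RoleExpr → RoleExpr → RoleExpr

data Logic : Set where
  ALCN̄ ALCQ : Logic

data Concept : Logic → Set where
  atom     : ∀ {L} → ℕ → Concept L
  top      : ∀ {L} → Concept L
  bot      : ∀ {L} → Concept L
  not      : ∀ {L} → Concept L → Concept L
  and      : ∀ {L} → Concept L → Concept L → Concept L
  or       : ∀ {L} → Concept L → Concept L → Concept L
  all      : ∀ {L} → RoleExpr → Concept L → Concept L
  ex       : ∀ {L} → RoleExpr → Concept L → Concept L
  atLeast  : ∀ {L} → ℕ → RoleExpr → Concept L
  atMost   : ∀ {L} → ℕ → RoleExpr → Concept L
  qAtLeast : ℕ → RoleExpr → Concept ALCQ → Concept ALCQ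
  qAtMost  : ℕ → RoleExpr → Concept ALCQ → Concept ALCQ

record Interpretation : Set₁ where
  field
    Δ       : Set
    nonempty : Δ
    conceptI : ℕ → Δ → Set
    roleI    : ℕ → Δ → Δ → Set

module _ (I : Interpretation) where
  open Interpretation I

  ⟦_⟧R : RoleExpr → Δ → Δ → Set
  ⟦ name p ⟧R i j   = roleI p i j
  ⟦ inv R ⟧R i j    = ⟦ R ⟧R j i
  ⟦ comp R S ⟧R i j = Σ Δ λ k → ⟦ R ⟧R i k × ⟦ S ⟧R k j

  AtLeast : ℕ → (Δ → Set) → Set
  AtLeast n P = Σ (Fin n → Δ) λ f →
    (∀ a b → f a ≡ f b → a ≡ b) × (∀ a → P (f a))

  AtMost : ℕ → (Δ → Set) → Set
  AtMost n P = ¬ AtLeast (suc n) P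

  ⟦_⟧C : ∀ {L} → Concept L → Δ → Set
  ⟦ atom A ⟧C i        = conceptI A i
  ⟦ top ⟧C i           = ⊤
  ⟦ bot ⟧C i           = ⊥
  ⟦ not C ⟧C i         = ¬ ⟦ C ⟧C i
  ⟦ and C D ⟧C i       = ⟦ C ⟧C i × ⟦ D ⟧C i
  ⟦ or C D ⟧C i        = ⟦ C ⟧C i ⊎ ⟦ D ⟧C i
  ⟦ all R C ⟧C i       = ∀ j → ⟦ R ⟧R i j → ⟦ C ⟧C j
  ⟦ ex R C ⟧C i        = Σ Δ λ j → ⟦ R ⟧R i j × ⟦ C ⟧C j
  ⟦ atLeast n R ⟧C i   = AtLeast n (⟦ R ⟧R i)
  ⟦ atMost n R ⟧C i    = AtMost n (⟦ R ⟧R i)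
  ⟦ qAtLeast n R C ⟧C i = AtLeast n (λ j → ⟦ R ⟧R i j × ⟦ C ⟧C j)
  ⟦ qAtMost n R C ⟧C i  = AtMost n (λ j → ⟦ R ⟧R i j × ⟦ C ⟧C j)

Satisfiable : ∀ {L} → Concept L → Set₁
Satisfiable C = Σ Interpretation λ I → Σ (Interpretation.Δ I) λ d → ⟦ I ⟧C C d

Subsumed : ∀ {L} → Concept L → Concept L → Set₁
Subsumed C D = (I : Interpretation) → ∀ d → ⟦ I ⟧C C d → ⟦ I ⟧C D d

-- Gödel numbering (Cantor pairing).

tri : ℕ → ℕ
tri zero    = zero
tri (suc n) = suc n + tri n

pair : ℕ → ℕ → ℕ
pair a b = tri (a + b) + b

⌜_⌝R : RoleExpr → ℕ
⌜ name p ⌝R   = pair 0 p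
⌜ inv R ⌝R    = pair 1 ⌜ R ⌝R
⌜ comp R S ⌝R = pair 2 (pair ⌜ R ⌝R ⌜ S ⌝R)

⌜_⌝ : ∀ {L} → Concept L → ℕ
⌜ atom A ⌝          = pair 0 A
⌜ top ⌝             = pair 1 0
⌜ bot ⌝             = pair 2 0
⌜ not C ⌝           = pair 3 ⌜ C ⌝
⌜ and C D ⌝         = pair 4 (pair ⌜ C ⌝ ⌜ D ⌝)
⌜ or C D ⌝          = pair 5 (pair ⌜ C ⌝ ⌜ D ⌝)
⌜ all R C ⌝         = pair 6 (pair ⌜ R ⌝R ⌜ C ⌝)
⌜ ex R C ⌝          = pair 7 (pair ⌜ R ⌝R ⌜ C ⌝)
⌜ atLeast n R ⌝     = pair 8 (pair n ⌜ R ⌝R)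
⌜ atMost n R ⌝      = pair 9 (pair n ⌜ R ⌝R)
⌜ qAtLeast n R C ⌝  = pair 10 (pair n (pair ⌜ R ⌝R ⌜ C ⌝))
⌜ qAtMost n R C ⌝   = pair 11 (pair n (pair ⌜ R ⌝R ⌜ C ⌝))

-- Model of computation: μ-recursive (partial recursive) functions.

data Code : ℕ → Set where
  Z    : ∀ {k} → Code k
  S    : Code 1
  P    : ∀ {k} → Fin k → Code k
  Comp : ∀ {k m} → Code m → Vec (Code k) m → Code k
  Rec  : ∀ {k} → Code k → Code (suc (suc k)) → Code (suc k)
  Mu   : ∀ {k} → Code (suc k) → Code k

data Eval : ∀ {k} → Code k → Vec ℕ k → ℕ → Set
data EvalAll : ∀ {k m} → Vec (Code k) m → Vec ℕ k → Vec ℕ m → Set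

data Eval where
  eZ    : ∀ {k} {xs : Vec ℕ k} → Eval Z xs 0
  eS    : ∀ {x} → Eval S (x ∷ []) (suc x)
  eP    : ∀ {k} {xs : Vec ℕ k} (i : Fin k) → Eval (P i) xs (lookup xs i)
  eComp : ∀ {k m} {f : Code m} {gs : Vec (Code k) m} {xs ys y} →
          EvalAll gs xs ys → Eval f ys y → Eval (Comp f gs) xs y
  eRec0 : ∀ {k} {g : Code k} {h} {xs y} →
          Eval g xs y → Eval (Rec g h) (0 ∷ xs) y
  eRecS : ∀ {k} {g : Code k} {h} {n xs y z} →
          Eval (Rec g h) (n ∷ xs) y → Eval h (n ∷ y ∷ xs) z →
          Eval (Rec g h) (suc n ∷ xs) z
  eMu   : ∀ {k} {f : Code (suc k)} {xs y} →
          Eval f (y ∷ xs) 0 →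
          (∀ i → i < y → Σ ℕ λ v → Eval f (i ∷ xs) (suc v)) →
          Eval (Mu f) xs y

data EvalAll where
  []  : ∀ {k} {xs : Vec ℕ k} → EvalAll [] xs []
  _∷_ : ∀ {k m} {g : Code k} {gs : Vec (Code k) m} {xs y ys} →
        Eval g xs y → EvalAll gs xs ys → EvalAll (g ∷ gs) xs (y ∷ ys)

Decides : ∀ {ℓ} → Code 1 → (ℕ → Set ℓ) → Set ℓ
Decides c Q = ∀ n → (Q n → Eval c (n ∷ []) 0) × (¬ Q n → Eval c (n ∷ []) 1)

Undecidable : ∀ {ℓ} → (ℕ → Set ℓ) → Set ℓ
Undecidable Q = ¬ Σ (Code 1) λ c → Decides c Q

SatProblem : Logic → ℕ → Set₁
SatProblem L n = Σ (Concept L) λ C → (⌜ C ⌝ ≡ n) × Satisfiable C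

SubsProblem : Logic → ℕ → Set₁
SubsProblem L n = Σ (Concept L) λ C → Σ (Concept L) λ D →
  (pair ⌜ C ⌝ ⌜ D ⌝ ≡ n) × Subsumed C D

{-# OPTIONS --safe #-}
-- For every recursive function e there is a concept base e such that, with
-- n recorded as the input, it is unsatisfiable if e(n) = 0 and satisfiable if
-- e(n) = 1. If c decided satisfiability, let e map the code n of a concept B to
-- c applied to the code of "B with input n"; on the code of base e itself, e
-- then contradicts c. Only the map from n to the code of "input n" has to be
-- recursive, so no numbering of programs is needed.
--
-- In base e, an element is a state whose registers point to numbers. All states
-- share one centre, where a universal restriction acts as a set of global
-- axioms. The axioms say that a register holds the value of a subprogram, with
-- guessed intermediate values. Equalities between successors of different
-- elements come from "at most one" restrictions on composed roles. In an
-- arbitrary interpretation these equalities hold only up to double negation,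
-- which suffices to refute satisfiability.
module Submission where

open import Defs
open import Data.Bool using (Bool; true; false) renaming (not to flip)
open import Data.Bool.Properties using (not-involutive; not-¬)
open import Data.Empty using (⊥; ⊥-elim)
open import Data.Fin using (Fin; zero; suc)
open import Data.Fin.Properties using (pigeonhole) renaming (<⇒≢ to <ᶠ⇒≢)
open import Data.List using (List; []; _∷_; _++_; length)
open import Data.Nat using (ℕ; zero; suc; _+_; _≤_; _<_; z≤n; s≤s; _≟_)
open import Data.Nat.Properties
open import Data.Product using (Σ; _×_; _,_; proj₁; proj₂)
open import Data.Sum using (_⊎_; inj₁; inj₂)
open import Data.Unit using (⊤; tt)
open import Data.Vec using (Vec; []; _∷_; lookup)
open import Data.Vec.Relation.Binary.Pointwise.Inductive using (Pointwise; []; _∷_) renaming (lookup to lookupᴾ)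
open import Data.Vec.Relation.Unary.All using (All; []; _∷_) renaming (head to headᴬ; tail to tailᴬ; map to mapᴬ; zip to zipᴬ)
open import Data.Vec.Relation.Unary.All.Properties using (lookup⁺)
open import Data.Vec.Relation.Unary.AllPairs using (AllPairs; []; _∷_)
open import Function using (_∘_; case_of_)
open import Relation.Binary.Definitions using (tri<; tri≈; tri>)
open import Relation.Binary.PropositionalEquality using (_≡_; _≢_; refl; sym; trans; cong; cong₂; subst)
open import Relation.Nullary using (¬_; yes; no)

-- Gödel numbers

tri-mono : ∀ {m n} → m ≤ n → tri m ≤ tri n
tri-mono z≤n       = z≤n
tri-mono (s≤s m≤n) = +-mono-≤ (s≤s m≤n) (tri-mono m≤n)

-- Since `b ≤ a + b`, the value `pair a b` lies below `tri (suc (a + b))`, so different diagonals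
-- occupy disjoint intervals.
pair-< : ∀ a b c d → a + b < c + d → pair a b < pair c d
pair-< a b c d lt = ≤-trans
  (s≤s (≤-trans (+-monoʳ-≤ (tri (a + b)) (m≤n+m b a)) (≤-reflexive (+-comm (tri (a + b)) (a + b)))))
  (≤-trans (tri-mono lt) (m≤m+n (tri (c + d)) d))

pair-injective : ∀ a b c d → pair a b ≡ pair c d → a ≡ c × b ≡ d
pair-injective a b c d eq with <-cmp (a + b) (c + d)
... | tri< lt _ _ = ⊥-elim (<-irrefl eq (pair-< a b c d lt))
... | tri> _ _ gt = ⊥-elim (<-irrefl (sym eq) (pair-< c d a b gt))
... | tri≈ _ a+b≡c+d _ = +-cancelʳ-≡ b a c (trans a+b≡c+d (cong (c +_) (sym b≡d))) , b≡d
  where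
  b≡d : b ≡ d
  b≡d = +-cancelˡ-≡ (tri (a + b)) b d (trans eq (cong (λ s → tri s + d) (sym a+b≡c+d)))

-- With the constructor tag split off, one use of `pair-injective` yields equal tags, and absurd tag
-- equations discard all pairs of different constructors.
tagR argR : RoleExpr → ℕ
tagR (name _)   = 0
tagR (inv _)    = 1
tagR (comp _ _) = 2
argR (name p)   = p
argR (inv R)    = ⌜ R ⌝R
argR (comp R Q) = pair ⌜ R ⌝R ⌜ Q ⌝R

⌜⌝R-pair : ∀ R → ⌜ R ⌝R ≡ pair (tagR R) (argR R)
⌜⌝R-pair (name _)   = refl
⌜⌝R-pair (inv _)    = refl
⌜⌝R-pair (comp _ _) = refl

tag arg : ∀ {L} → Concept L → ℕ
tag (atom _)         = 0
tag top              = 1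
tag bot              = 2
tag (not _)          = 3
tag (and _ _)        = 4
tag (or _ _)         = 5
tag (all _ _)        = 6
tag (ex _ _)         = 7
tag (atLeast _ _)    = 8
tag (atMost _ _)     = 9
tag (qAtLeast _ _ _) = 10
tag (qAtMost _ _ _)  = 11
arg (atom A)         = A
arg top              = 0
arg bot              = 0
arg (not C)          = ⌜ C ⌝
arg (and C D)        = pair ⌜ C ⌝ ⌜ D ⌝
arg (or C D)         = pair ⌜ C ⌝ ⌜ D ⌝
arg (all R C)        = pair ⌜ R ⌝R ⌜ C ⌝
arg (ex R C)         = pair ⌜ R ⌝R ⌜ C ⌝
arg (atLeast n R)    = pair n ⌜ R ⌝R
arg (atMost n R)     = pair n ⌜ R ⌝R
arg (qAtLeast n R C) = pair n (pair ⌜ R ⌝R ⌜ C ⌝)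
arg (qAtMost n R C)  = pair n (pair ⌜ R ⌝R ⌜ C ⌝)

⌜⌝-pair : ∀ {L} (C : Concept L) → ⌜ C ⌝ ≡ pair (tag C) (arg C)
⌜⌝-pair (atom _)         = refl
⌜⌝-pair top              = refl
⌜⌝-pair bot              = refl
⌜⌝-pair (not _)          = refl
⌜⌝-pair (and _ _)        = refl
⌜⌝-pair (or _ _)         = refl
⌜⌝-pair (all _ _)        = refl
⌜⌝-pair (ex _ _)         = refl
⌜⌝-pair (atLeast _ _)    = refl
⌜⌝-pair (atMost _ _)     = refl
⌜⌝-pair (qAtLeast _ _ _) = refl
⌜⌝-pair (qAtMost _ _ _)  = refl

⌜⌝R-injective : ∀ R R′ → ⌜ R ⌝R ≡ ⌜ R′ ⌝R → R ≡ R′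
argR-injective : ∀ R R′ → tagR R ≡ tagR R′ → argR R ≡ argR R′ → R ≡ R′

⌜⌝R-injective R R′ eq = argR-injective R R′ (proj₁ eqs) (proj₂ eqs)
  where
  eqs : tagR R ≡ tagR R′ × argR R ≡ argR R′
  eqs = pair-injective (tagR R) (argR R) (tagR R′) (argR R′)
          (trans (sym (⌜⌝R-pair R)) (trans eq (⌜⌝R-pair R′)))

argR-injective (name p) (name .p) refl refl = refl
argR-injective (inv R) (inv R′) refl eq = cong inv (⌜⌝R-injective R R′ eq)
argR-injective (comp R Q) (comp R′ Q′) refl eq with pair-injective ⌜ R ⌝R ⌜ Q ⌝R ⌜ R′ ⌝R ⌜ Q′ ⌝R eq
... | eqR , eqQ = cong₂ comp (⌜⌝R-injective R R′ eqR) (⌜⌝R-injective Q Q′ eqQ)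

-- `SatProblem` and `SubsProblem` quantify over all concepts with a given number, so refuting them
-- at the number of `C` requires that `C` be the only such concept.
⌜⌝-injective : ∀ {L} (C D : Concept L) → ⌜ C ⌝ ≡ ⌜ D ⌝ → C ≡ D
arg-injective : ∀ {L} (C D : Concept L) → tag C ≡ tag D → arg C ≡ arg D → C ≡ D

⌜⌝-injective C D eq = arg-injective C D (proj₁ eqs) (proj₂ eqs)
  where
  eqs : tag C ≡ tag D × arg C ≡ arg D
  eqs = pair-injective (tag C) (arg C) (tag D) (arg D)
          (trans (sym (⌜⌝-pair C)) (trans eq (⌜⌝-pair D)))

arg-injective (atom A) (atom .A) refl refl = refl
arg-injective top top refl _ = refl
arg-injective bot bot refl _ = refl
arg-injective (not C) (not D) refl eq = cong not (⌜⌝-injective C D eq)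
arg-injective (and C C′) (and D D′) refl eq with pair-injective ⌜ C ⌝ ⌜ C′ ⌝ ⌜ D ⌝ ⌜ D′ ⌝ eq
... | p , q = cong₂ and (⌜⌝-injective C D p) (⌜⌝-injective C′ D′ q)
arg-injective (or C C′) (or D D′) refl eq with pair-injective ⌜ C ⌝ ⌜ C′ ⌝ ⌜ D ⌝ ⌜ D′ ⌝ eq
... | p , q = cong₂ or (⌜⌝-injective C D p) (⌜⌝-injective C′ D′ q)
arg-injective (all R C) (all R′ D) refl eq with pair-injective ⌜ R ⌝R ⌜ C ⌝ ⌜ R′ ⌝R ⌜ D ⌝ eq
... | p , q = cong₂ all (⌜⌝R-injective R R′ p) (⌜⌝-injective C D q)
arg-injective (ex R C) (ex R′ D) refl eq with pair-injective ⌜ R ⌝R ⌜ C ⌝ ⌜ R′ ⌝R ⌜ D ⌝ eq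
... | p , q = cong₂ ex (⌜⌝R-injective R R′ p) (⌜⌝-injective C D q)
arg-injective (atLeast n R) (atLeast n′ R′) refl eq with pair-injective n ⌜ R ⌝R n′ ⌜ R′ ⌝R eq
... | p , q = cong₂ atLeast p (⌜⌝R-injective R R′ q)
arg-injective (atMost n R) (atMost n′ R′) refl eq with pair-injective n ⌜ R ⌝R n′ ⌜ R′ ⌝R eq
... | p , q = cong₂ atMost p (⌜⌝R-injective R R′ q)
arg-injective (qAtLeast n R C) (qAtLeast n′ R′ D) refl eq
  with pair-injective n (pair ⌜ R ⌝R ⌜ C ⌝) n′ (pair ⌜ R′ ⌝R ⌜ D ⌝) eq
... | refl , q with pair-injective ⌜ R ⌝R ⌜ C ⌝ ⌜ R′ ⌝R ⌜ D ⌝ q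
... | p , r = cong₂ (qAtLeast n) (⌜⌝R-injective R R′ p) (⌜⌝-injective C D r)
arg-injective (qAtMost n R C) (qAtMost n′ R′ D) refl eq
  with pair-injective n (pair ⌜ R ⌝R ⌜ C ⌝) n′ (pair ⌜ R′ ⌝R ⌜ D ⌝) eq
... | refl , q with pair-injective ⌜ R ⌝R ⌜ C ⌝ ⌜ R′ ⌝R ⌜ D ⌝ q
... | p , r = cong₂ (qAtMost n) (⌜⌝R-injective R R′ p) (⌜⌝-injective C D r)

-- Recursive functions on Gödel numbers

constᶜ : ∀ {k} → ℕ → Code k
constᶜ zero    = Z
constᶜ (suc n) = Comp S (constᶜ n ∷ [])

constᶜ-eval : ∀ {k} {xs : Vec ℕ k} n → Eval (constᶜ n) xs n
constᶜ-eval zero    = eZ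
constᶜ-eval (suc n) = eComp (constᶜ-eval n ∷ []) eS

addᶜ : Code 2
addᶜ = Rec (P zero) (Comp S (P (suc zero) ∷ []))

addᶜ-eval : ∀ m n → Eval addᶜ (m ∷ n ∷ []) (m + n)
addᶜ-eval zero    n = eRec0 (eP zero)
addᶜ-eval (suc m) n = eRecS (addᶜ-eval m n) (eComp (eP (suc zero) ∷ []) eS)

triᶜ : Code 1
triᶜ = Rec Z (Comp S (Comp addᶜ (P zero ∷ P (suc zero) ∷ []) ∷ []))

triᶜ-eval : ∀ n → Eval triᶜ (n ∷ []) (tri n)
triᶜ-eval zero    = eRec0 eZ
triᶜ-eval (suc n) = eRecS (triᶜ-eval n)
  (eComp (eComp (eP zero ∷ eP (suc zero) ∷ []) (addᶜ-eval n (tri n)) ∷ []) eS)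

pairᶜ : ∀ {k} → Code k → Code k → Code k
pairᶜ f g = Comp addᶜ (Comp triᶜ (Comp addᶜ (f ∷ g ∷ []) ∷ []) ∷ g ∷ [])

pairᶜ-eval : ∀ {k} {f g : Code k} {xs a b} → Eval f xs a → Eval g xs b → Eval (pairᶜ f g) xs (pair a b)
pairᶜ-eval {a = a} {b} f⇓a g⇓b = eComp
  (eComp (eComp (f⇓a ∷ g⇓b ∷ []) (addᶜ-eval a b) ∷ []) (triᶜ-eval (a + b)) ∷ g⇓b ∷ [])
  (addᶜ-eval (tri (a + b)) b)

-- Concepts with holes, limited to the constructors met around a hole in a move, so that the number
-- of a filled context is a recursive function of the number of the filler.
data Context (L : Logic) : Set where
  hole     : Context L
  con      : Concept L → Context L
  andˣ orˣ : Context L → Context L → Context L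
  exˣ      : RoleExpr → Context L → Context L

fill : ∀ {L} → Context L → Concept L → Concept L
fill hole       X = X
fill (con C)    X = C
fill (andˣ κ κ′) X = and (fill κ X) (fill κ′ X)
fill (orˣ κ κ′)  X = or (fill κ X) (fill κ′ X)
fill (exˣ R κ)  X = ex R (fill κ X)

fillᶜ : ∀ {L k} → Context L → Code k → Code k
fillᶜ hole       f = f
fillᶜ (con C)    f = constᶜ ⌜ C ⌝
-- The constants 4, 5 and 7 are the tags of `and`, `or` and `ex`.
fillᶜ (andˣ κ κ′) f = pairᶜ (constᶜ 4) (pairᶜ (fillᶜ κ f) (fillᶜ κ′ f))
fillᶜ (orˣ κ κ′)  f = pairᶜ (constᶜ 5) (pairᶜ (fillᶜ κ f) (fillᶜ κ′ f))
fillᶜ (exˣ R κ)  f = pairᶜ (constᶜ 7) (pairᶜ (constᶜ ⌜ R ⌝R) (fillᶜ κ f))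

fillᶜ-eval : ∀ {L k} (κ : Context L) {f : Code k} {xs} X → Eval f xs ⌜ X ⌝ →
             Eval (fillᶜ κ f) xs ⌜ fill κ X ⌝
fillᶜ-eval hole       X f⇓ = f⇓
fillᶜ-eval (con C)    X f⇓ = constᶜ-eval ⌜ C ⌝
fillᶜ-eval (andˣ κ κ′) X f⇓ = pairᶜ-eval (constᶜ-eval 4) (pairᶜ-eval (fillᶜ-eval κ X f⇓) (fillᶜ-eval κ′ X f⇓))
fillᶜ-eval (orˣ κ κ′)  X f⇓ = pairᶜ-eval (constᶜ-eval 5) (pairᶜ-eval (fillᶜ-eval κ X f⇓) (fillᶜ-eval κ′ X f⇓))
fillᶜ-eval (exˣ R κ)  X f⇓ = pairᶜ-eval (constᶜ-eval 7) (pairᶜ-eval (constᶜ-eval ⌜ R ⌝R) (fillᶜ-eval κ X f⇓))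

-- Register formulas and the relational compilation of codes

data Direction : Set where
  up down : Direction

-- A formula is evaluated at a state, which assigns numbers to registers.
-- guess ks φ moves to a state with the same values in ks and arbitrary other
-- values; step d s ks φ moves likewise but also adds (up) or subtracts (down)
-- one in register s.
data Formula : Set where
  trivial       : Formula
  isZero isPos  : ℕ → Formula
  goto          : ℕ → Formula
  _∧_ _∨_       : Formula → Formula → Formula
  guess         : ∀ {j} → Vec ℕ j → Formula → Formula
  step          : ∀ {j} → Direction → ℕ → Vec ℕ j → Formula → Formula

range : ℕ → ∀ m → Vec ℕ m
range b zero    = []
range b (suc m) = b ∷ range (suc b) m

-- Stored under its own label `ℓ`, this formula counts `a` and `c` down together until both are
-- zero.
equal : ℕ → ℕ → ℕ → Formula
equal a c ℓ = (isZero a ∧ isZero c) ∨ step down a (c ∷ []) (step down c (a ∷ []) (goto ℓ))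

-- form f ins out b ℓ says that register out holds the value of f at the
-- registers ins. Registers from b on are scratch space, and the labels from ℓ
-- on name the formulas of the list clauses f ins out b ℓ.
form       : ∀ {k} → Code k → Vec ℕ k → ℕ → ℕ → ℕ → Formula
clauses    : ∀ {k} → Code k → Vec ℕ k → ℕ → ℕ → ℕ → List Formula
formAll    : ∀ {k m} → Vec (Code k) m → Vec ℕ k → Vec ℕ m → ℕ → ℕ → Formula
clausesAll : ∀ {k m} → Vec (Code k) m → Vec ℕ k → Vec ℕ m → ℕ → ℕ → List Formula
compForm   : ∀ {k m} → Code m → Vec (Code k) m → Vec ℕ k → Vec ℕ m → ℕ → ℕ → ℕ → Formula
muForm     : ∀ {k} → Code (suc k) → Vec ℕ k → ℕ → ℕ → ℕ → Formula
recNext    : ∀ {k} → Code k → Code (suc (suc k)) → ℕ → Vec ℕ k → ℕ → ℕ → ℕ → ℕ → ℕ → Formula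
recForm    : ∀ {k} → Code k → Code (suc (suc k)) → ℕ → Vec ℕ k → ℕ → ℕ → ℕ → ℕ → ℕ → Formula
recClauses : ∀ {k} → Code k → Code (suc (suc k)) → ℕ → Vec ℕ k → ℕ → ℕ → ℕ → ℕ → List Formula

form Z           ins       out b ℓ = isZero out
form S           (x ∷ [])  out b ℓ = step down out (x ∷ []) (goto ℓ)
form (P i)       ins       out b ℓ = goto ℓ
form (Comp {m = m} f gs) ins out b ℓ = guess (out ∷ ins) (compForm f gs ins (range b m) out (b + m) ℓ)
form (Rec g h)   (n ∷ ins) out b ℓ = goto ℓ
form (Mu f)      ins       out b ℓ = guess (out ∷ ins) (isZero b ∧ goto ℓ)

clauses Z           ins       out b ℓ = []
clauses S           (x ∷ [])  out b ℓ = equal x out ℓ ∷ []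
clauses (P i)       ins       out b ℓ = equal (lookup ins i) out ℓ ∷ []
clauses (Comp {m = m} f gs) ins out b ℓ =
  clausesAll gs ins ys (b + m) ℓ ++
  clauses f ys out (b + m) (ℓ + length (clausesAll gs ins ys (b + m) ℓ))
  where ys = range b m
-- The two clauses exchange the roles of out and b, so that the intermediate
-- value of one becomes the output of the other.
clauses (Rec g h)   (n ∷ ins) out b ℓ =
  recForm g h n ins out b (suc b) (2 + ℓ) (1 + ℓ) ∷
  recForm g h n ins b out (suc b) (2 + ℓ + length (recClauses g h n ins out b (suc b) (2 + ℓ))) ℓ ∷
  recClauses g h n ins out b (suc b) (2 + ℓ) ++
  recClauses g h n ins b out (suc b) (2 + ℓ + length (recClauses g h n ins out b (suc b) (2 + ℓ)))
clauses (Mu f)      ins       out b ℓ =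
  guess (b ∷ out ∷ ins) (muForm f ins out b ℓ) ∷
  equal b out (1 + ℓ) ∷
  clauses f (b ∷ ins) (suc b) (2 + b) (2 + ℓ)

formAll []       ins []       b ℓ = trivial
formAll (g ∷ gs) ins (y ∷ ys) b ℓ =
  form g ins y b ℓ ∧ formAll gs ins ys b (ℓ + length (clauses g ins y b ℓ))

clausesAll []       ins []       b ℓ = []
clausesAll (g ∷ gs) ins (y ∷ ys) b ℓ =
  clauses g ins y b ℓ ++ clausesAll gs ins ys b (ℓ + length (clauses g ins y b ℓ))

compForm f gs ins ys out b ℓ =
  formAll gs ins ys b ℓ ∧ form f ys out b (ℓ + length (clausesAll gs ins ys b ℓ))

-- The search runs upwards from zero, because an output guessed by an arbitrary
-- interpretation might be a nonstandard number with an infinite descent.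
muForm f ins out b ℓ =
  form f (b ∷ ins) (suc b) (2 + b) (2 + ℓ) ∧
  ((isZero (suc b) ∧ goto (1 + ℓ)) ∨ (isPos (suc b) ∧ step up b (out ∷ ins) (goto ℓ)))

recNext g h n ins out tmp b ℓ next =
  form h (n ∷ tmp ∷ ins) out b (ℓ + length (clauses g ins out b ℓ)) ∧ goto next

recForm g h n ins out tmp b ℓ next =
  -- The move does not keep `tmp`, which thus takes a guessed value; `next` checks that it is the
  -- result at the predecessor.
  (isZero n ∧ form g ins out b ℓ) ∨ step down n (out ∷ ins) (recNext g h n ins out tmp b ℓ next)

recClauses g h n ins out tmp b ℓ =
  clauses g ins out b ℓ ++ clauses h (n ∷ tmp ∷ ins) out b (ℓ + length (clauses g ins out b ℓ))

-- `Q` becomes `Unfolds` for soundness and `Entry` for completeness, so both share one bookkeeping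
-- of labels.
At : (ℕ → Formula → Set) → ℕ → List Formula → Set
At Q ℓ []       = ⊤
At Q ℓ (φ ∷ φs) = Q ℓ φ × At Q (suc ℓ) φs

At-++ : ∀ {Q} ℓ φs {ψs} → At Q ℓ (φs ++ ψs) → At Q ℓ φs × At Q (ℓ + length φs) ψs
At-++ {Q} ℓ [] {ψs} at = tt , subst (λ l → At Q l ψs) (sym (+-identityʳ ℓ)) at
At-++ {Q} ℓ (φ ∷ φs) {ψs} (q , at) with At-++ (suc ℓ) φs at
... | at₁ , at₂ = (q , at₁) , subst (λ l → At Q l ψs) (sym (+-suc ℓ (length φs))) at₂

-- Formulas as concepts

centre edge : RoleExpr
centre = name 0
edge   = name 1

link : Bool → RoleExpr
link false = name 2
link true  = name 3

slot : ℕ → RoleExpr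
slot s = name (4 + s)

zeroᴬ : ∀ {L} → Concept L
zeroᴬ = atom 0

parityᴬ : ∀ {L} → Bool → Concept L
parityᴬ false = atom 1
parityᴬ true  = atom 2

labelᴬ : ∀ {L} → ℕ → Concept L
labelᴬ ℓ = atom (3 + ℓ)

-- The base cases treat the centre, so that a move leads to a state with the same centre, where the
-- table applies again.
has share : ∀ {L j} → Vec ℕ j → Concept L
has []       = ex centre top
has (s ∷ ks) = and (ex (slot s) top) (has ks)
share []       = atMost 1 (comp edge centre)
share (s ∷ ks) = and (atMost 1 (comp edge (slot s))) (share ks)

exactParity : ∀ {L} → Bool → Concept L
exactParity b = and (parityᴬ b) (not (parityᴬ (flip b)))

-- A number n is tied by a bond of parity n to its predecessor and by one of
-- the other parity to its successor. Because parities alternate, sharing a bond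
-- is again a condition "at most one edge ∘ slot ∘ link", and as a bond ties at
-- most two numbers the predecessor is unique.
upper lower joined : ∀ {L} → Bool → ℕ → Concept L
upper b s = and (atMost 1 (slot s)) (ex (slot s) (and (exactParity b) (and (not zeroᴬ) (ex (link b) top))))
lower b s = and (atMost 1 (slot s)) (ex (slot s) (and (exactParity (flip b)) (ex (link b) top)))
joined b s = and (atMost 1 (comp edge (comp (slot s) (link b))))
                 (all edge (all (slot s) (all (link b) (atMost 2 (inv (link b))))))

-- Two states are joined by a node with edges to both, so that "at most one
-- edge ∘ R" at this node makes their R-successors coincide.
moveˣ : ∀ {L j} → Vec ℕ j → Concept L → Concept L → Concept L → Context L
moveˣ ks A T D =
  andˣ (con (and A (has ks)))
    (exˣ (inv edge) (andˣ (con (and T (share ks)))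
      (exˣ edge (andˣ (con (and D (has ks))) hole))))

source target : ∀ {L} → Direction → Bool → ℕ → Concept L
source up   = lower
source down = upper
target up   = upper
target down = lower

branchˣ : ∀ {L j} → Bool → Direction → ℕ → Vec ℕ j → Context L
branchˣ b d s ks = moveˣ ks (source d b s) (joined b s) (target d b s)

-- The parity of the larger number is not known in advance, hence one branch for each parity.
stepˣ : ∀ {L j} → Direction → ℕ → Vec ℕ j → Context L
stepˣ d s ks = orˣ (branchˣ false d s ks) (branchˣ true d s ks)

⟨_⟩ : ∀ {L} → Formula → Concept L
⟨ trivial ⟩       = top
⟨ isZero s ⟩      = and (ex (slot s) top) (all (slot s) zeroᴬ)
⟨ isPos s ⟩       = all (slot s) (not zeroᴬ)
⟨ goto ℓ ⟩        = labelᴬ ℓ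
⟨ φ ∧ ψ ⟩         = and ⟨ φ ⟩ ⟨ ψ ⟩
⟨ φ ∨ ψ ⟩         = or ⟨ φ ⟩ ⟨ ψ ⟩
⟨ guess ks φ ⟩    = fill (moveˣ ks top top top) ⟨ φ ⟩
⟨ step d s ks φ ⟩ = fill (stepˣ d s ks) ⟨ φ ⟩

-- The implication label → φ, in a form that needs no excluded middle in models.
clauseᴬ : ∀ {L} → ℕ → Formula → Concept L
clauseᴬ ℓ φ = not (and (labelᴬ ℓ) (not ⟨ φ ⟩))

table : ∀ {L} → ℕ → List Formula → Concept L
table ℓ []       = top
table ℓ (φ ∷ φs) = and (clauseᴬ ℓ φ) (table (suc ℓ) φs)

inputIs : ℕ → Formula
inputIs zero    = isZero 0
inputIs (suc n) = step down 0 [] (inputIs n)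

-- Register 0 is the input, register 1 the output, and scratch space starts at 2. Output 0
-- contradicts `isPos 1`, while output 1 agrees with it.
base : ∀ {L} → Code 1 → Concept L
base e = and (ex centre (all (inv centre) (table 0 (clauses e (0 ∷ []) 1 2 0))))
             (and ⟨ form e (0 ∷ []) 1 2 0 ⟩ ⟨ isPos 1 ⟩)

-- Every interpretation respects the evaluation relation

Pointwise-map : ∀ {H H′ : ℕ → ℕ → Set} {k} {ss xs : Vec ℕ k} →
                All (λ s → ∀ v → H s v → H′ s v) ss → Pointwise H ss xs → Pointwise H′ ss xs
Pointwise-map []       []       = []
Pointwise-map (f ∷ fs) (h ∷ hs) = f _ h ∷ Pointwise-map fs hs

module _ (I : Interpretation) where
  open Interpretation I

  atMost1-unique : ∀ R {i x y} → AtMost I 1 (⟦ I ⟧R R i) → ⟦ I ⟧R R i x → ⟦ I ⟧R R i y → ¬ ¬ x ≡ y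
  atMost1-unique R {i} {x} {y} am ix iy x≢y = am (f , inj , related)
    where
    f : Fin 2 → Δ
    f zero       = x
    f (suc zero) = y
    inj : ∀ a b → f a ≡ f b → a ≡ b
    inj zero       zero       _  = refl
    inj zero       (suc zero) eq = ⊥-elim (x≢y eq)
    inj (suc zero) zero       eq = ⊥-elim (x≢y (sym eq))
    inj (suc zero) (suc zero) _  = refl
    related : ∀ a → ⟦ I ⟧R R i (f a)
    related zero       = ix
    related (suc zero) = iy

  atMost2-unique : ∀ R {i x y z} → AtMost I 2 (⟦ I ⟧R R i) →
                   ⟦ I ⟧R R i x → ⟦ I ⟧R R i y → ⟦ I ⟧R R i z →
                   x ≢ y → x ≢ z → ¬ ¬ y ≡ z
  atMost2-unique R {i} {x} {y} {z} am ix iy iz x≢y x≢z y≢z = am (f , inj , related)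
    where
    f : Fin 3 → Δ
    f zero             = x
    f (suc zero)       = y
    f (suc (suc zero)) = z
    inj : ∀ a b → f a ≡ f b → a ≡ b
    inj zero             zero             _  = refl
    inj zero             (suc zero)       eq = ⊥-elim (x≢y eq)
    inj zero             (suc (suc zero)) eq = ⊥-elim (x≢z eq)
    inj (suc zero)       zero             eq = ⊥-elim (x≢y (sym eq))
    inj (suc zero)       (suc zero)       _  = refl
    inj (suc zero)       (suc (suc zero)) eq = ⊥-elim (y≢z eq)
    inj (suc (suc zero)) zero             eq = ⊥-elim (x≢z (sym eq))
    inj (suc (suc zero)) (suc zero)       eq = ⊥-elim (y≢z (sym eq))
    inj (suc (suc zero)) (suc (suc zero)) _  = refl
    related : ∀ a → ⟦ I ⟧R R i (f a)
    related zero             = ix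
    related (suc zero)       = iy
    related (suc (suc zero)) = iz

module Soundness (L : Logic) (I : Interpretation) (c : Interpretation.Δ I) where
  open Interpretation I

  infix 4 _⊩_
  _⊩_ : Δ → Concept L → Set
  x ⊩ C = ⟦ I ⟧C C x

  Role : RoleExpr → Δ → Δ → Set
  Role = ⟦ I ⟧R

  Good : Δ → Set
  Good x = Role centre x c

  record Successor (m n : Δ) : Set where
    constructor successor
    field
      par   : Bool
      n-par : n ⊩ exactParity par
      m-par : m ⊩ exactParity (flip par)
      n-pos : ¬ (n ⊩ zeroᴬ)
      l     : Δ
      n-l   : Role (link par) n l
      m-l   : Role (link par) m l
      fun   : AtMost I 1 (Role (link par) n)
      two   : AtMost I 2 (λ j → Role (link par) j l)

  distinct-parity : ∀ {m n} b → n ⊩ exactParity b → m ⊩ exactParity (flip b) → n ≢ m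
  distinct-parity b (nb , _) (_ , ¬mb) refl = ¬mb (subst (λ p → _ ⊩ parityᴬ p) (sym (not-involutive b)) nb)

  -- As `n` has exactly one parity, both bonds have that parity and coincide by `fun`. The bond ties
  -- at most two numbers, one of them `n`, and parity separates `n` from `m` and `m′`.
  Successor-unique : ∀ {m m′ n} → Successor m n → Successor m′ n → ¬ ¬ m ≡ m′
  Successor-unique {m} {m′} {n} (successor b n-b m-b _ l n-l m-l fun two)
                                (successor b′ n-b′ m′-b _ l′ n-l′ m′-l _ _) = go b b′ refl refl
    where
    go : ∀ p p′ → p ≡ b → p′ ≡ b′ → ¬ ¬ m ≡ m′
    go false true  refl refl = λ _ → proj₂ n-b (proj₁ n-b′)
    go true  false refl refl = λ _ → proj₂ n-b (proj₁ n-b′)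
    go false false refl refl = λ k → atMost1-unique I (link b) fun n-l n-l′ λ { refl →
      atMost2-unique I (inv (link b)) two n-l m-l m′-l (distinct-parity b n-b m-b) (distinct-parity b n-b′ m′-b) k }
    go true  true  refl refl = λ k → atMost1-unique I (link b) fun n-l n-l′ λ { refl →
      atMost2-unique I (inv (link b)) two n-l m-l m′-l (distinct-parity b n-b m-b) (distinct-parity b n-b′ m′-b) k }

  Represents : ℕ → Δ → Set
  Represents zero    n = n ⊩ zeroᴬ
  Represents (suc v) n = Σ Δ λ m → Successor m n × Represents v m

  -- Being a negation, this lets equalities known only up to double negation be used as equations in
  -- its proofs.
  Holds : Δ → ℕ → ℕ → Set
  Holds x s v = ¬ ¬ Σ Δ λ n → Role (slot s) x n × Represents v n

  Same : Δ → Δ → ℕ → Set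
  Same x y s = (∀ v → Holds x s v → Holds y s v) × (∀ v → Holds y s v → Holds x s v)

  -- The last component closes the cases in which a register holding 0 would be decremented.
  Above : Δ → Δ → ℕ → Set
  Above x y s = (∀ v → Holds x s (suc v) → Holds y s v) ×
                (∀ v → Holds y s v → Holds x s (suc v)) × ¬ Holds x s 0

  Stepped : Direction → ℕ → Δ → Δ → Set
  Stepped up   s x y = Above y x s
  Stepped down s x y = Above x y s

  isZero-holds : ∀ {x s} → x ⊩ ⟨ isZero s ⟩ → Holds x s 0
  isZero-holds ((n , xn , _) , z) k = k (n , xn , z n xn)

  isZero-not-suc : ∀ {x s v} → x ⊩ ⟨ isZero s ⟩ → ¬ Holds x s (suc v)
  isZero-not-suc (_ , z) h = h λ { (n , xn , _ , sc , _) → Successor.n-pos sc (z n xn) }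

  isPos-not-zero : ∀ {x s} → x ⊩ ⟨ isPos s ⟩ → ¬ Holds x s 0
  isPos-not-zero p h = h λ { (n , xn , z) → p n xn z }

  module _ {t x y : Δ} (tx : Role edge t x) (ty : Role edge t y) where

    -- Each side has a successor, and the bound at `t` makes any two of them coincide.
    share-holds : ∀ {s} → t ⊩ atMost 1 (comp edge (slot s)) → x ⊩ ex (slot s) top → y ⊩ ex (slot s) top →
                  Same x y s
    share-holds {s} am (n , xn , _) (m , ym , _) =
      (λ v h k → h λ { (n′ , xn′ , r) → atMost1-unique I (comp edge (slot s)) am (x , tx , xn′) (y , ty , ym) λ { refl → k (m , ym , r) } }) ,
      (λ v h k → h λ { (m′ , ym′ , r) → atMost1-unique I (comp edge (slot s)) am (y , ty , ym′) (x , tx , xn) λ { refl → k (n , xn , r) } })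

    share-all : ∀ {j} (ks : Vec ℕ j) → t ⊩ share ks → x ⊩ has ks → y ⊩ has ks → All (Same x y) ks
    share-all []       _         _         _         = []
    share-all (s ∷ ks) (am , ts) (xs , xh) (ys , yh) = share-holds am xs ys ∷ share-all ks ts xh yh

    share-good : ∀ {j} (ks : Vec ℕ j) → t ⊩ share ks → y ⊩ has ks → Good x → ¬ ¬ Good y
    share-good []       am       (c′ , yc , _) xc k =
      atMost1-unique I (comp edge centre) am (y , ty , yc) (x , tx , xc) λ { refl → k yc }
    share-good (s ∷ ks) (_ , ts) (_ , yh)      xc k = share-good ks ts yh xc k

    -- The bound at `t` identifies the bonds of the two numbers, which therefore form a `Successor`
    -- pair. Since the slots of `x` and `y` are functional, every represented value passes through
    -- this pair.
    joined-above : ∀ b {s} → x ⊩ upper b s → t ⊩ joined b s → y ⊩ lower b s → ¬ ¬ Above x y s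
    joined-above b {s} (am-x , n , xn , n-par , n-pos , l , nl , _) (am-l , two)
                 (am-y , m , ym , m-par , l′ , ml , _) k =
      atMost1-unique I (comp edge (comp (slot s) (link b))) am-l (y , ty , m , ym , ml) (x , tx , n , xn , nl) λ { refl →
      let sc : Successor m n
          sc = successor b n-par m-par n-pos l nl ml
                 -- Every `link b` successor of `n` is also reached from `t`, so the bound at `t`
                 -- applies to `n`.
                 (λ { (f , inj , fs) → am-l (f , inj , λ a → x , tx , n , xn , fs a) })
                 (two x tx n xn l nl)
      in k ((λ v h k′ → h λ { (n′ , xn′ , m′ , sc′ , r) →
               atMost1-unique I (slot s) am-x xn′ xn λ { refl →
               Successor-unique sc′ sc λ { refl → k′ (m , ym , r) } } }) ,
            (λ v h k′ → h λ { (m′ , ym′ , r) →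
               atMost1-unique I (slot s) am-y ym′ ym λ { refl → k′ (n , xn , m , sc , r) } }) ,
            (λ h → h λ { (n′ , xn′ , z) → atMost1-unique I (slot s) am-x xn′ xn λ { refl → n-pos z } })) }

  -- Stated as an elimination into `⊥`, because the new state is attached to `c` only up to double
  -- negation.
  move-elim : ∀ {j} (ks : Vec ℕ j) A T D X {x} → Good x → x ⊩ fill (moveˣ ks A T D) X →
              (∀ t y → Role edge t x → Role edge t y → x ⊩ A → t ⊩ T → y ⊩ D →
                 Good y → y ⊩ X → All (Same x y) ks → ⊥) → ⊥
  move-elim ks A T D X gx ((xA , xh) , t , tx , (tT , ts) , y , ty , (yD , yh) , yX) k =
    share-good tx ty ks ts yh gx λ gy →
    k t y tx ty xA tT yD gy yX (share-all tx ty ks ts xh yh)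

  guess-elim : ∀ {j} (ks : Vec ℕ j) φ {x} → Good x → x ⊩ ⟨ guess ks φ ⟩ →
               (∀ y → Good y → y ⊩ ⟨ φ ⟩ → All (Same x y) ks → ⊥) → ⊥
  guess-elim ks φ gx xφ k =
    move-elim ks top top top ⟨ φ ⟩ gx xφ λ _ y _ _ _ _ _ gy yφ same → k y gy yφ same

  branch-elim : ∀ {j} b d s (ks : Vec ℕ j) φ {x} → Good x → x ⊩ fill (branchˣ b d s ks) ⟨ φ ⟩ →
                (∀ y → Good y → y ⊩ ⟨ φ ⟩ → All (Same x y) ks → Stepped d s x y → ⊥) → ⊥
  branch-elim b d s ks φ gx xφ k =
    move-elim ks (source d b s) (joined b s) (target d b s) ⟨ φ ⟩ gx xφ λ t y tx ty xA tT yD gy yφ same →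
    stepped d tx ty xA tT yD (k y gy yφ same)
    where
    stepped : ∀ d {t x y} → Role edge t x → Role edge t y →
              x ⊩ source d b s → t ⊩ joined b s → y ⊩ target d b s → ¬ ¬ Stepped d s x y
    stepped up   tx ty xA tT yD = joined-above ty tx b yD tT xA
    stepped down tx ty xA tT yD = joined-above tx ty b xA tT yD

  step-elim : ∀ {j} d s (ks : Vec ℕ j) φ {x} → Good x → x ⊩ ⟨ step d s ks φ ⟩ →
              (∀ y → Good y → y ⊩ ⟨ φ ⟩ → All (Same x y) ks → Stepped d s x y → ⊥) → ⊥
  step-elim d s ks φ gx (inj₁ xφ) = branch-elim false d s ks φ gx xφ
  step-elim d s ks φ gx (inj₂ xφ) = branch-elim true d s ks φ gx xφ

  Unfolds : ℕ → Formula → Set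
  Unfolds ℓ φ = ∀ x → Good x → x ⊩ ⟨ goto ℓ ⟩ → ¬ ¬ (x ⊩ ⟨ φ ⟩)

  table-unfolds : ∀ ℓ φs → (∀ x → Good x → x ⊩ table ℓ φs) → At Unfolds ℓ φs
  table-unfolds ℓ []       _ = tt
  table-unfolds ℓ (φ ∷ φs) h =
    (λ x gx xℓ ¬xφ → proj₁ (h x gx) (xℓ , ¬xφ)) , table-unfolds (suc ℓ) φs (λ x gx → proj₂ (h x gx))

  forward : ∀ {x y k} {ss xs : Vec ℕ k} → All (Same x y) ss → Pointwise (Holds x) ss xs → Pointwise (Holds y) ss xs
  forward same = Pointwise-map (mapᴬ proj₁ same)

  -- Induction on the value of `a`, which is a standard number; that `d` holds a standard number is
  -- part of the conclusion.
  equal-sound : ∀ v {a d ℓ x} → Unfolds ℓ (equal a d ℓ) → Good x → x ⊩ ⟨ goto ℓ ⟩ →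
                Holds x a v → Holds x d v
  equal-sound v {a} {d} {ℓ} {x} unf gx xℓ ha k = unf x gx xℓ λ
    { (inj₁ (za , zd)) → zero-case v za zd ha k
    ; (inj₂ xφ) → step-elim down a (d ∷ []) (step down d (a ∷ []) (goto ℓ)) gx xφ λ
      { y gy yφ ((_ , d-back) ∷ []) a-above → step-elim down d (a ∷ []) (goto ℓ) gy yφ λ
        { z gz zℓ ((a-fwd , _) ∷ []) d-above → suc-case v a-above d-back a-fwd d-above gz zℓ ha k } } }
    where
    zero-case : ∀ v → x ⊩ ⟨ isZero a ⟩ → x ⊩ ⟨ isZero d ⟩ → Holds x a v → Holds x d v
    zero-case zero    za zd _ = isZero-holds zd
    zero-case (suc v) za zd h = ⊥-elim (isZero-not-suc {s = a} {v} za h)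
    suc-case : ∀ v {y z} → Above x y a → (∀ w → Holds y d w → Holds x d w) →
               (∀ w → Holds y a w → Holds z a w) → Above y z d → Good z → z ⊩ ⟨ goto ℓ ⟩ →
               Holds x a v → Holds x d v
    suc-case zero    (_ , _ , pos)   _      _     _               _  _  h = ⊥-elim (pos h)
    suc-case (suc v) (a-down , _) d-back a-fwd (_ , d-up , _) gz zℓ h =
      -- By induction `d` holds `v` at `z`, hence `suc v` at `y`, and the first move left `d`
      -- unchanged.
      d-back (suc v) (d-up v (equal-sound v unf gz zℓ (a-fwd v (a-down v h))))

  -- Only the inputs are assumed to hold standard numbers. The guessed registers are then forced to
  -- the correct values in the order of evaluation.
  sound : ∀ {k} (f : Code k) {xs v ins out b ℓ x} → Eval f xs v →
          At Unfolds ℓ (clauses f ins out b ℓ) → Good x → x ⊩ ⟨ form f ins out b ℓ ⟩ →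
          Pointwise (Holds x) ins xs → Holds x out v
  sound-all : ∀ {k m} (gs : Vec (Code k) m) {xs vs ins outs b ℓ x} → EvalAll gs xs vs →
          At Unfolds ℓ (clausesAll gs ins outs b ℓ) → Good x → x ⊩ ⟨ formAll gs ins outs b ℓ ⟩ →
          Pointwise (Holds x) ins xs → Pointwise (Holds x) outs vs
  -- Descending the recursion alternates between two clauses, so each recursive call exchanges the
  -- hypotheses on `self` and `next`.
  sound-rec : ∀ {k} (g : Code k) h {xs n v r ins out tmp b ℓ ℓ′ self next x} → Eval (Rec g h) (n ∷ xs) v →
          Unfolds self (recForm g h r ins out tmp b ℓ next) → At Unfolds ℓ (recClauses g h r ins out tmp b ℓ) →
          Unfolds next (recForm g h r ins tmp out b ℓ′ self) → At Unfolds ℓ′ (recClauses g h r ins tmp out b ℓ′) →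
          Good x → x ⊩ ⟨ goto self ⟩ → Holds x r n → Pointwise (Holds x) ins xs → Holds x out v
  -- Here `i` is the candidate in register `b`, and `j` counts the candidates left to reject before
  -- `v`.
  sound-mu : ∀ {k} (f : Code (suc k)) {xs v ins out b ℓ} i j {x} → i + j ≡ v →
          Eval f (v ∷ xs) 0 → (∀ i → i < v → Σ ℕ λ w → Eval f (i ∷ xs) (suc w)) →
          At Unfolds ℓ (clauses (Mu f) ins out b ℓ) → Good x → x ⊩ ⟨ goto ℓ ⟩ →
          Holds x b i → Pointwise (Holds x) ins xs → Holds x out v

  sound Z eZ _ _ z _ = isZero-holds z
  sound S {ins = a ∷ []} {out} {ℓ = ℓ} (eS {n}) (unf , _) gx xφ (h ∷ []) k =
    step-elim down out (a ∷ []) (goto ℓ) gx xφ λ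
      { y gy yℓ ((fwd , _) ∷ []) (_ , out-up , _) →
        out-up n (equal-sound n {a} {out} unf gy yℓ (fwd n h)) k }
  sound (P i) {xs} (eP .i) (unf , _) gx xℓ hs = equal-sound (lookup xs i) unf gx xℓ (lookupᴾ hs i)
  sound (Comp {m = m} f gs) {v = v} {ins} {out} {b} {ℓ} (eComp evs ev) at gx xφ hs k
    with At-++ ℓ (clausesAll gs ins (range b m) (b + m) ℓ) at
  ... | at-gs , at-f = guess-elim (out ∷ ins) (compForm f gs ins (range b m) out (b + m) ℓ) gx xφ λ
    { y gy (yφs , yφ) (same-out ∷ same) →
      proj₂ same-out v (sound f ev at-f gy yφ (sound-all gs evs at-gs gy yφs (forward same hs))) k }
  sound (Rec g h) {ins = r ∷ ins} {out} {b} {ℓ} ev (unf , unf′ , at) gx xℓ (hr ∷ hs)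
    with At-++ (2 + ℓ) (recClauses g h r ins out b (suc b) (2 + ℓ)) at
  ... | at₁ , at₂ = sound-rec g h ev unf at₁ unf′ at₂ gx xℓ hr hs
  sound (Mu f) {v = v} {ins} {out} {b} {ℓ} (eMu ev evs) at gx xφ hs k =
    guess-elim (out ∷ ins) (isZero b ∧ goto ℓ) gx xφ λ
      { y gy (z , yℓ) (same-out ∷ same) →
        proj₂ same-out v (sound-mu f {ins = ins} {out} {b} {ℓ} 0 v refl ev evs at gy yℓ (isZero-holds z) (forward same hs)) k }

  sound-all []       {outs = []} [] _ _ _ _ = []
  sound-all (g ∷ gs) {ins = ins} {out ∷ outs} {b} {ℓ} (ev ∷ evs) at gx (xφ , xφs) hs
    with At-++ ℓ (clauses g ins out b ℓ) at
  ... | at₁ , at₂ = sound g ev at₁ gx xφ hs ∷ sound-all gs evs at₂ gx xφs hs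

  sound-rec g h {n = zero} {r = r} {ins} {out} {tmp} {b} {ℓ} {next = next} {x} (eRec0 ev) unf at unf′ at′ gx xℓ hr hs k
    with At-++ ℓ (clauses g ins out b ℓ) at
  ... | at-g , _ = unf x gx xℓ λ
    { (inj₁ (_ , xφ)) → sound g ev at-g gx xφ hs k
    ; (inj₂ xφ) → step-elim down r (out ∷ ins) (recNext g h r ins out tmp b ℓ next) gx xφ λ { _ _ _ _ (_ , _ , pos) → pos hr } }
  sound-rec g h {n = suc n} {v} {r} {ins} {out} {tmp} {b} {ℓ} {next = next} {x} (eRecS ev ev′) unf at unf′ at′ gx xℓ hr hs k
    with At-++ ℓ (clauses g ins out b ℓ) at
  ... | _ , at-h = unf x gx xℓ λ
    { (inj₁ (z , _)) → isZero-not-suc {s = r} {n} z hr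
    ; (inj₂ xφ) → step-elim down r (out ∷ ins) (recNext g h r ins out tmp b ℓ next) gx xφ λ
      { y gy (yφ , yℓ) (same-out ∷ same) (r-down , _) →
        let hr′ = r-down n hr
            hs′ = forward same hs
        in proj₂ same-out v
             (sound h ev′ at-h gy yφ (hr′ ∷ sound-rec g h ev unf′ at′ unf at gy yℓ hr′ hs′ ∷ hs′)) k } }

  sound-mu f {v = v} {ins} {out} {b} {ℓ} i zero {x} i+0≡v ev evs (unf , unf-eq , at) gx xℓ hi hs k =
    unf x gx xℓ λ xφ → guess-elim (b ∷ out ∷ ins) (muForm f ins out b ℓ) gx xφ λ
      { y gy (yφ , rest) ((b-fwd , _) ∷ same-out ∷ same) →
        let hv = subst (Holds y b) (trans (sym (+-identityʳ i)) i+0≡v) (b-fwd i hi)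
            hw = sound f ev at gy yφ (hv ∷ forward same hs)
        -- The candidate is `v`, so the test register `suc b` holds 0 and the search cannot
        -- continue.
        in case rest of λ
          { (inj₁ (_ , yℓ)) → proj₂ same-out v (equal-sound v unf-eq gy yℓ hv) k
          ; (inj₂ (pos , _)) → isPos-not-zero {s = suc b} pos hw } }
  sound-mu f {v = v} {ins} {out} {b} {ℓ} i (suc j) {x} i+sj≡v ev evs at@(unf , _ , at-f) gx xℓ hi hs k
    with evs i (subst (i <_) i+sj≡v (m<m+n i (s≤s z≤n)))
  ... | w , evᵢ = unf x gx xℓ λ xφ → guess-elim (b ∷ out ∷ ins) (muForm f ins out b ℓ) gx xφ λ
    { y gy (yφ , rest) ((b-fwd , _) ∷ same-out ∷ same) →
      let hi′ = b-fwd i hi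
          hs′ = forward same hs
          hw  = sound f evᵢ at-f gy yφ (hi′ ∷ hs′)
      in case rest of λ
        { (inj₁ (z , _)) → isZero-not-suc {s = suc b} {w} z hw
        ; (inj₂ (_ , yψ)) → step-elim up b (out ∷ ins) (goto ℓ) gy yψ λ
          { z gz zℓ (same-out′ ∷ same′) (_ , b-up , _) →
            proj₂ same-out v (proj₂ same-out′ v
              (sound-mu f {ins = ins} {out} {b} {ℓ} (suc i) j (trans (sym (+-suc i j)) i+sj≡v) ev evs at gz zℓ
                (b-up i hi′) (forward same′ hs′))) k } } }

  inputIs-sound : ∀ n {x} → Good x → x ⊩ ⟨ inputIs n ⟩ → Holds x 0 n
  inputIs-sound zero    gx xφ   = isZero-holds xφ
  inputIs-sound (suc n) gx xφ k = step-elim down 0 [] (inputIs n) gx xφ λ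
    { y gy yφ _ (_ , 0-up , _) → 0-up n (inputIs-sound n gy yφ) k }

base-unsat : ∀ {L} (e : Code 1) n → Eval e (n ∷ []) 0 → ¬ Satisfiable {L} (and (base e) ⟨ inputIs n ⟩)
base-unsat {L} e n ev (I , x , ((c , xc , tab) , xφ , pos) , xin) =
  isPos-not-zero {s = 1} pos
    (sound e ev (table-unfolds 0 (clauses e (0 ∷ []) 1 2 0) tab) xc xφ (inputIs-sound n xc xin ∷ []))
  where open Soundness L I c

-- Derivations of formulas at assignments of numbers to registers

Assignment : Set
Assignment = ℕ → ℕ

infix 9 _[_≔_]
_[_≔_] : Assignment → ℕ → ℕ → Assignment
(ρ [ s ≔ v ]) t with t ≟ s
... | yes _ = v
... | no _  = ρ t

update-same : ∀ ρ s {v} → (ρ [ s ≔ v ]) s ≡ v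
update-same ρ s with s ≟ s
... | yes _  = refl
... | no s≢s = ⊥-elim (s≢s refl)

update-other : ∀ ρ s {v t} → s ≢ t → (ρ [ s ≔ v ]) t ≡ ρ t
update-other ρ s {t = t} s≢t with t ≟ s
... | yes t≡s = ⊥-elim (s≢t (sym t≡s))
... | no _    = refl

Agree : Assignment → Assignment → ∀ {k} → Vec ℕ k → Set
Agree ρ ρ′ = All (λ s → ρ′ s ≡ ρ s)

Values : Assignment → ∀ {k} → Vec ℕ k → Vec ℕ k → Set
Values ρ = Pointwise (λ s v → ρ s ≡ v)

update-agree : ∀ ρ s {v k} {ss : Vec ℕ k} → All (s ≢_) ss → Agree ρ (ρ [ s ≔ v ]) ss
update-agree ρ s = mapᴬ (update-other ρ s)

Agree-trans : ∀ {ρ ρ′ ρ″ k} {ss : Vec ℕ k} → Agree ρ ρ′ ss → Agree ρ′ ρ″ ss → Agree ρ ρ″ ss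
Agree-trans []       []       = []
Agree-trans (p ∷ ps) (q ∷ qs) = trans q p ∷ Agree-trans ps qs

Agree-values : ∀ {ρ ρ′ k} {ss vs : Vec ℕ k} → Agree ρ ρ′ ss → Values ρ ss vs → Values ρ′ ss vs
Agree-values agree = Pointwise-map (mapᴬ (λ p _ q → trans p q) agree)

assign : Assignment → ℕ → ∀ {m} → Vec ℕ m → Assignment
assign ρ b []       = ρ
assign ρ b (v ∷ vs) = assign ρ (suc b) vs [ b ≔ v ]

assign-below : ∀ ρ b {m} (vs : Vec ℕ m) {s} → s < b → assign ρ b vs s ≡ ρ s
assign-below ρ b []       s<b = refl
assign-below ρ b (v ∷ vs) s<b =
  trans (update-other (assign ρ (suc b) vs) b (>⇒≢ s<b)) (assign-below ρ (suc b) vs (m<n⇒m<1+n s<b))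

range-≥ : ∀ b m → All (b ≤_) (range b m)
range-≥ b zero    = []
range-≥ b (suc m) = ≤-refl ∷ mapᴬ (≤-trans (n≤1+n b)) (range-≥ (suc b) m)

range-< : ∀ b m → All (_< b + m) (range b m)
range-< b zero    = []
range-< b (suc m) = m<m+n b (s≤s z≤n) ∷ mapᴬ (λ lt → ≤-trans lt (≤-reflexive (sym (+-suc b m)))) (range-< (suc b) m)

range-distinct : ∀ b m → AllPairs _≢_ (range b m)
range-distinct b zero    = []
range-distinct b (suc m) = mapᴬ <⇒≢ (range-≥ (suc b) m) ∷ range-distinct (suc b) m

assign-range : ∀ ρ b {m} (vs : Vec ℕ m) → Values (assign ρ b vs) (range b m) vs
assign-range ρ b         []       = []
assign-range ρ b {suc m} (v ∷ vs) =
  update-same (assign ρ (suc b) vs) b ∷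
  Agree-values (update-agree (assign ρ (suc b) vs) b (mapᴬ <⇒≢ (range-≥ (suc b) m))) (assign-range ρ (suc b) vs)

-- This ensures that updating a scratch register, or one of the listed registers, leaves the other
-- listed ones unchanged.
Fresh : ℕ → ∀ {k} → Vec ℕ k → Set
Fresh b ss = All (_< b) ss × AllPairs _≢_ ss

Fresh-cons : ∀ {b k} {ss : Vec ℕ k} → Fresh b ss → Fresh (suc b) (b ∷ ss)
Fresh-cons {b} (lts , ap) =
  (≤-refl ∷ mapᴬ m<n⇒m<1+n lts) , (mapᴬ >⇒≢ lts ∷ ap)

Fresh-swap : ∀ {b k s t} {ss : Vec ℕ k} → Fresh b (s ∷ t ∷ ss) → Fresh b (t ∷ s ∷ ss)
Fresh-swap (ls ∷ lt ∷ lts , (s≢t ∷ s≢) ∷ t≢ ∷ ap) =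
  (lt ∷ ls ∷ lts) , ((λ t≡s → s≢t (sym t≡s)) ∷ t≢) ∷ s≢ ∷ ap

Fresh-swap₂ : ∀ {b k o s t} {ss : Vec ℕ k} → Fresh b (o ∷ s ∷ t ∷ ss) → Fresh b (o ∷ t ∷ s ∷ ss)
Fresh-swap₂ (lo ∷ lts , (o≢s ∷ o≢t ∷ o≢) ∷ ap) with Fresh-swap (lts , ap)
... | lts′ , ap′ = (lo ∷ lts′) , (o≢t ∷ o≢s ∷ o≢) ∷ ap′

Fresh-tail : ∀ {b k s} {ss : Vec ℕ k} → Fresh b (s ∷ ss) → Fresh b ss
Fresh-tail (_ ∷ lts , _ ∷ ap) = lts , ap

Fresh-drop : ∀ {b k s t} {ss : Vec ℕ k} → Fresh b (s ∷ t ∷ ss) → Fresh b (s ∷ ss)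
Fresh-drop = Fresh-tail ∘ Fresh-swap

Fresh-head : ∀ {b k s} {ss : Vec ℕ k} → Fresh b (s ∷ ss) → All (s ≢_) ss
Fresh-head (_ , s≢ ∷ _) = s≢

Fresh-range : ∀ b m {k} {ss : Vec ℕ k} → Fresh b ss → All (λ s → Fresh (b + m) (s ∷ ss)) (range b m)
Fresh-range b m (lts , ap) = mapᴬ
  (λ { (b≤s , s<b+m) →
       (s<b+m ∷ mapᴬ (λ lt → ≤-trans lt (m≤m+n b m)) lts) ,
       (mapᴬ (λ lt → >⇒≢ (≤-trans lt b≤s)) lts ∷ ap) })
  (zipᴬ (range-≥ b m , range-< b m))

Steps : Direction → ℕ → ℕ → Set
Steps up   m n = n ≡ suc m
Steps down m n = m ≡ suc n

-- Labels may refer to each other cyclically; their truth in the intended model is the existence of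
-- a finite derivation.
data Derives (T : ℕ → Formula) : Formula → Assignment → Set where
  trivialᵈ : ∀ {ρ} → Derives T trivial ρ
  isZeroᵈ  : ∀ {ρ s} → ρ s ≡ 0 → Derives T (isZero s) ρ
  isPosᵈ   : ∀ {ρ s} → ρ s ≢ 0 → Derives T (isPos s) ρ
  gotoᵈ    : ∀ {ρ ℓ} → Derives T (T ℓ) ρ → Derives T (goto ℓ) ρ
  andᵈ     : ∀ {ρ φ ψ} → Derives T φ ρ → Derives T ψ ρ → Derives T (φ ∧ ψ) ρ
  leftᵈ    : ∀ {ρ φ ψ} → Derives T φ ρ → Derives T (φ ∨ ψ) ρ
  rightᵈ   : ∀ {ρ φ ψ} → Derives T ψ ρ → Derives T (φ ∨ ψ) ρ
  guessᵈ   : ∀ {ρ φ j} {ks : Vec ℕ j} ρ′ → Agree ρ ρ′ ks → Derives T φ ρ′ → Derives T (guess ks φ) ρ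
  stepᵈ    : ∀ {ρ φ d s j} {ks : Vec ℕ j} ρ′ → Agree ρ ρ′ ks → Steps d (ρ s) (ρ′ s) →
             Derives T φ ρ′ → Derives T (step d s ks φ) ρ

module Completeness (T : ℕ → Formula) where

  Entry : ℕ → Formula → Set
  Entry ℓ φ = T ℓ ≡ φ

  unfold : ∀ {ℓ φ ρ} → Entry ℓ φ → Derives T φ ρ → Derives T (goto ℓ) ρ
  unfold refl = gotoᵈ

  equal-complete : ∀ v {a d ℓ ρ} → Entry ℓ (equal a d ℓ) → a ≢ d → ρ a ≡ v → ρ d ≡ v → Derives T (goto ℓ) ρ
  equal-complete zero    entry a≢d ρa ρd = unfold entry (leftᵈ (andᵈ (isZeroᵈ ρa) (isZeroᵈ ρd)))
  equal-complete (suc v) {a} {d} {ℓ} {ρ} entry a≢d ρa ρd = unfold entry (rightᵈ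
    (stepᵈ ρ₁ (ρ₁d ∷ []) (trans ρa (cong suc (sym ρ₁a)))
      (stepᵈ ρ₂ (ρ₂a ∷ []) (trans ρ₁d (trans ρd (cong suc (sym ρ₂d))))
        (equal-complete v entry a≢d (trans ρ₂a ρ₁a) ρ₂d))))
    where
    ρ₁ ρ₂ : Assignment
    ρ₁ = ρ [ a ≔ v ]
    ρ₂ = ρ₁ [ d ≔ v ]
    ρ₁a : ρ₁ a ≡ v
    ρ₁a = update-same ρ a
    ρ₁d : ρ₁ d ≡ ρ d
    ρ₁d = update-other ρ a a≢d
    ρ₂a : ρ₂ a ≡ ρ₁ a
    ρ₂a = update-other ρ₁ d (a≢d ∘ sym)
    ρ₂d : ρ₂ d ≡ v
    ρ₂d = update-same ρ₁ d

  -- The evaluation supplies the values to guess for the scratch registers, and its finiteness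
  -- bounds the unfolding of labels.
  complete : ∀ {k} (f : Code k) {xs v ins out b ℓ ρ} → Eval f xs v →
          At Entry ℓ (clauses f ins out b ℓ) → Fresh b (out ∷ ins) →
          Values ρ ins xs → ρ out ≡ v → Derives T (form f ins out b ℓ) ρ
  complete-all : ∀ {k m} (gs : Vec (Code k) m) {xs vs ins outs b ℓ ρ} → EvalAll gs xs vs →
          At Entry ℓ (clausesAll gs ins outs b ℓ) → All (λ out → Fresh b (out ∷ ins)) outs →
          Values ρ ins xs → Values ρ outs vs → Derives T (formAll gs ins outs b ℓ) ρ
  complete-rec : ∀ {k} (g : Code k) h {xs n v r ins out tmp b ℓ ℓ′ self next ρ} → Eval (Rec g h) (n ∷ xs) v →
          Entry self (recForm g h r ins out tmp b ℓ next) → At Entry ℓ (recClauses g h r ins out tmp b ℓ) →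
          Entry next (recForm g h r ins tmp out b ℓ′ self) → At Entry ℓ′ (recClauses g h r ins tmp out b ℓ′) →
          Fresh b (out ∷ tmp ∷ r ∷ ins) →
          ρ r ≡ n → Values ρ ins xs → ρ out ≡ v → Derives T (goto self) ρ
  complete-mu : ∀ {k} (f : Code (suc k)) {xs v ins out b ℓ} i j {ρ} → i + j ≡ v →
          Eval f (v ∷ xs) 0 → (∀ i → i < v → Σ ℕ λ w → Eval f (i ∷ xs) (suc w)) →
          At Entry ℓ (clauses (Mu f) ins out b ℓ) → Fresh b (out ∷ ins) →
          ρ b ≡ i → Values ρ ins xs → ρ out ≡ v → Derives T (goto ℓ) ρ

  complete Z eZ _ _ _ ρo = isZeroᵈ ρo
  complete S {ins = a ∷ []} {out} {ρ = ρ} (eS {n}) (entry , _) (_ , (o≢a ∷ []) ∷ _) (ρa ∷ []) ρo =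
    stepᵈ (ρ [ out ≔ n ]) (update-other ρ out o≢a ∷ []) (trans ρo (cong suc (sym (update-same ρ out))))
      (equal-complete n entry (o≢a ∘ sym) (trans (update-other ρ out o≢a) ρa) (update-same ρ out))
  complete (P i) {xs} (eP .i) (entry , _) fr ρs ρo =
    equal-complete (lookup xs i) entry (λ eq → lookup⁺ (Fresh-head fr) i (sym eq)) (lookupᴾ ρs i) ρo
  complete (Comp {m = m} f gs) {ins = ins} {out} {b} {ℓ} {ρ} (eComp {ys = vs} evs ev) at (lts@(o<b ∷ _) , ap) ρs ρo
    with At-++ ℓ (clausesAll gs ins (range b m) (b + m) ℓ) at
  ... | at-gs , at-f = guessᵈ ρ′ agree (andᵈ
    (complete-all gs evs at-gs (Fresh-range b m (Fresh-tail (lts , ap))) (Agree-values (tailᴬ agree) ρs) ρ′ys)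
    (complete f ev at-f fresh-f ρ′ys (trans (headᴬ agree) ρo)))
    where
    ρ′ : Assignment
    ρ′ = assign ρ b vs
    agree : Agree ρ ρ′ (out ∷ ins)
    agree = mapᴬ (assign-below ρ b vs) lts
    ρ′ys : Values ρ′ (range b m) vs
    ρ′ys = assign-range ρ b vs
    fresh-f : Fresh (b + m) (out ∷ range b m)
    fresh-f = (≤-trans o<b (m≤m+n b m) ∷ range-< b m) ,
              (mapᴬ (λ b≤s → <⇒≢ (≤-trans o<b b≤s)) (range-≥ b m) ∷ range-distinct b m)
  complete (Rec g h) {ins = r ∷ ins} {out} {b} {ℓ} ev (entry , entry′ , at) fr (ρr ∷ ρs) ρo
    with At-++ (2 + ℓ) (recClauses g h r ins out b (suc b) (2 + ℓ)) at
  ... | at₁ , at₂ = complete-rec g h ev entry at₁ entry′ at₂ (Fresh-swap (Fresh-cons fr)) ρr ρs ρo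
  complete (Mu f) {v = v} {ins} {out} {b} {ℓ} {ρ} (eMu ev evs) at fr ρs ρo =
    guessᵈ (ρ [ b ≔ 0 ]) agree (andᵈ (isZeroᵈ (update-same ρ b))
      (complete-mu f {ins = ins} {out} {b} {ℓ} 0 v refl ev evs at fr (update-same ρ b)
        (Agree-values (tailᴬ agree) ρs) (trans (headᴬ agree) ρo)))
    where
    agree : Agree ρ (ρ [ b ≔ 0 ]) (out ∷ ins)
    agree = update-agree ρ b (Fresh-head (Fresh-cons fr))

  complete-all []       {outs = []} [] _ _ _ _ = trivialᵈ
  complete-all (g ∷ gs) {ins = ins} {out ∷ outs} {b} {ℓ} (ev ∷ evs) at (fr ∷ frs) ρs (ρo ∷ ρos)
    with At-++ ℓ (clauses g ins out b ℓ) at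
  ... | at₁ , at₂ = andᵈ (complete g ev at₁ fr ρs ρo) (complete-all gs evs at₂ frs ρs ρos)

  complete-rec g h {r = r} {ins} {out} {tmp} {b} {ℓ} (eRec0 ev) entry at entry′ at′ fr ρr ρs ρo
    with At-++ ℓ (clauses g ins out b ℓ) at
  ... | at-g , _ = unfold entry (leftᵈ (andᵈ (isZeroᵈ ρr) (complete g ev at-g (Fresh-drop (Fresh-drop fr)) ρs ρo)))
  complete-rec g h {r = r} {ins} {out} {tmp} {b} {ℓ} {ρ = ρ} (eRecS {n = n} {y = y} ev ev′) entry at entry′ at′ fr ρr ρs ρo
    with At-++ ℓ (clauses g ins out b ℓ) at
  ... | _ , at-h = unfold entry (rightᵈ (stepᵈ ρ′ agree (trans ρr (cong suc (sym ρ′r)))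
    (andᵈ (complete h ev′ at-h (Fresh-swap₂ fr) (ρ′r ∷ ρ′tmp ∷ ρ′s) (trans (headᴬ agree) ρo))
          (complete-rec g h ev entry′ at′ entry at (Fresh-swap fr) ρ′r ρ′s ρ′tmp))))
    where
    ρ′ : Assignment
    -- The guess for `tmp` is `y`, the value of the recursion at `n`.
    ρ′ = ρ [ r ≔ n ] [ tmp ≔ y ]
    tmp-fr : All (tmp ≢_) (out ∷ r ∷ ins)
    tmp-fr = Fresh-head (Fresh-swap fr)
    agree : Agree ρ ρ′ (out ∷ ins)
    agree = Agree-trans (update-agree ρ r (Fresh-head (Fresh-swap (Fresh-drop fr))))
                        (update-agree (ρ [ r ≔ n ]) tmp (headᴬ tmp-fr ∷ tailᴬ (tailᴬ tmp-fr)))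
    ρ′r : ρ′ r ≡ n
    ρ′r = trans (update-other (ρ [ r ≔ n ]) tmp (headᴬ (tailᴬ tmp-fr))) (update-same ρ r)
    ρ′tmp : ρ′ tmp ≡ y
    ρ′tmp = update-same (ρ [ r ≔ n ]) tmp
    ρ′s : Values ρ′ ins _
    ρ′s = Agree-values (tailᴬ agree) ρs

  complete-mu f {v = v} {ins} {out} {b} {ℓ} i zero {ρ} i+0≡v ev evs (entry , entry-eq , at) fr ρi ρs ρo =
    unfold entry (guessᵈ ρ′ agree (andᵈ
      (complete f ev at (Fresh-drop (Fresh-swap₂ fr₂)) (ρ′b ∷ Agree-values (tailᴬ (tailᴬ agree)) ρs) ρ′w)
      (leftᵈ (andᵈ (isZeroᵈ ρ′w)
        (equal-complete v entry-eq (headᴬ (Fresh-head (Fresh-cons fr))) ρ′b (trans (headᴬ (tailᴬ agree)) ρo))))))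
    where
    fr₂ : Fresh (2 + b) (suc b ∷ b ∷ out ∷ ins)
    fr₂ = Fresh-cons (Fresh-cons fr)
    ρ′ : Assignment
    ρ′ = ρ [ suc b ≔ 0 ]
    agree : Agree ρ ρ′ (b ∷ out ∷ ins)
    agree = update-agree ρ (suc b) (Fresh-head fr₂)
    ρ′b : ρ′ b ≡ v
    ρ′b = trans (headᴬ agree) (trans ρi (trans (sym (+-identityʳ i)) i+0≡v))
    ρ′w : ρ′ (suc b) ≡ 0
    ρ′w = update-same ρ (suc b)
  complete-mu f {xs} {v} {ins} {out} {b} {ℓ} i (suc j) {ρ} i+sj≡v ev evs at@(entry , _ , at-f) fr ρi ρs ρo
    with evs i (subst (i <_) i+sj≡v (m<m+n i (s≤s z≤n)))
  ... | w , evᵢ = unfold entry (guessᵈ ρ′ agree (andᵈ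
      (complete f evᵢ at-f (Fresh-drop (Fresh-swap₂ fr₂)) (ρ′b ∷ ρ′s) ρ′w)
      (rightᵈ (andᵈ (isPosᵈ (λ z → 1+n≢0 (trans (sym ρ′w) z)))
        (stepᵈ ρ″ agree′ (trans (update-same ρ′ b) (cong suc (sym ρ′b)))
          (complete-mu f {ins = ins} {out} {b} {ℓ} (suc i) j (trans (sym (+-suc i j)) i+sj≡v) ev evs at fr
            (update-same ρ′ b) (Agree-values (tailᴬ agree′) ρ′s)
            (trans (headᴬ agree′) (trans (headᴬ (tailᴬ agree)) ρo))))))))
    where
    fr₂ : Fresh (2 + b) (suc b ∷ b ∷ out ∷ ins)
    fr₂ = Fresh-cons (Fresh-cons fr)
    ρ′ ρ″ : Assignment
    -- The test register receives the positive value of `f` at the rejected candidate `i`; then `b`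
    -- advances to the next candidate.
    ρ′ = ρ [ suc b ≔ suc w ]
    ρ″ = ρ′ [ b ≔ suc i ]
    agree : Agree ρ ρ′ (b ∷ out ∷ ins)
    agree = update-agree ρ (suc b) (Fresh-head fr₂)
    agree′ : Agree ρ′ ρ″ (out ∷ ins)
    agree′ = update-agree ρ′ b (Fresh-head (Fresh-cons fr))
    ρ′b : ρ′ b ≡ i
    ρ′b = trans (headᴬ agree) ρi
    ρ′s : Values ρ′ ins xs
    ρ′s = Agree-values (tailᴬ (tailᴬ agree)) ρs
    ρ′w : ρ′ (suc b) ≡ suc w
    ρ′w = update-same ρ (suc b)

-- The intended model

-- There is a `join` for every two assignments; the formulas select the pairs that form a move.
-- `bond (suc n)` ties `n` to `suc n`.
data Node : Set where
  hub    : Node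
  state  : Assignment → Node
  join   : Assignment → Assignment → Node
  number : ℕ → Node
  bond   : ℕ → Node

parity : ℕ → Bool
parity zero    = false
parity (suc n) = flip (parity n)

data Hub : Node → Node → Set where
  toHub : ∀ {ρ} → Hub (state ρ) hub

data Edge : Node → Node → Set where
  first  : ∀ {ρ ρ′} → Edge (join ρ ρ′) (state ρ)
  second : ∀ {ρ ρ′} → Edge (join ρ ρ′) (state ρ′)

-- `bond n` has the parity of `n`, so each number has exactly one bond of either parity.
data Link (b : Bool) : Node → Node → Set where
  same : ∀ {n} → parity n ≡ b → Link b (number n) (bond n)
  next : ∀ {n} → parity (suc n) ≡ b → Link b (number n) (bond (suc n))

data Slot (s : ℕ) : Node → Node → Set where
  value : ∀ {ρ} → Slot s (state ρ) (number (ρ s))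

data Numeric (Q : ℕ → Set) : Node → Set where
  numeric : ∀ {n} → Q n → Numeric Q (number n)

data Marked (T : ℕ → Formula) (ℓ : ℕ) : Node → Set where
  marked : ∀ {ρ} → Derives T (goto ℓ) ρ → Marked T ℓ (state ρ)

model : (ℕ → Formula) → Interpretation
model T = record
  { Δ        = Node
  ; nonempty = hub
  ; conceptI = concepts
  ; roleI    = roles
  }
  where
  concepts : ℕ → Node → Set
  concepts 0                   = Numeric (_≡ 0)
  concepts 1                   = Numeric (λ n → parity n ≡ false)
  concepts 2                   = Numeric (λ n → parity n ≡ true)
  concepts (suc (suc (suc ℓ))) = Marked T ℓ
  roles : ℕ → Node → Node → Set
  roles 0                         = Hub
  roles 1                         = Edge
  roles 2                         = Link false
  roles 3                         = Link true
  roles (suc (suc (suc (suc s)))) = Slot s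

module _ (I : Interpretation) (R : RoleExpr) where

  -- By the pigeonhole principle, two of `suc n` successors share a class. The class may depend on
  -- the proof of the role, so links can be classified by their constructor.
  atMost-classes : ∀ {i} n (class : ∀ j → ⟦ I ⟧R R i j → Fin n) →
                   (∀ j k r r′ → class j r ≡ class k r′ → j ≡ k) → AtMost I n (⟦ I ⟧R R i)
  atMost-classes n class separates (f , inj , f-R)
    with pigeonhole (n<1+n n) (λ a → class (f a) (f-R a))
  ... | a , b , a<b , eq = <ᶠ⇒≢ a<b (inj a b (separates (f a) (f b) (f-R a) (f-R b) eq))

  atMost-one : ∀ {i} j → (∀ k → ⟦ I ⟧R R i k → k ≡ j) → AtMost I 1 (⟦ I ⟧R R i)
  atMost-one j only = atMost-classes 1 (λ _ _ → zero) (λ k k′ r r′ _ → trans (only k r) (sym (only k′ r′)))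

module Model (L : Logic) (T : ℕ → Formula) where

  M : Interpretation
  M = model T

  infix 4 _⊩_
  _⊩_ : Node → Concept L → Set
  x ⊩ C = ⟦ M ⟧C C x

  link⁺ : ∀ b {i j} → Link b i j → ⟦ M ⟧R (link b) i j
  link⁺ false r = r
  link⁺ true  r = r

  link⁻ : ∀ b {i j} → ⟦ M ⟧R (link b) i j → Link b i j
  link⁻ false r = r
  link⁻ true  r = r

  exactParity-model : ∀ b {n} → parity n ≡ b → number n ⊩ exactParity b
  exactParity-model false eq = numeric eq , λ { (numeric eq′) → not-¬ eq eq′ }
  exactParity-model true  eq = numeric eq , λ { (numeric eq′) → not-¬ eq eq′ }

  slot-model : ∀ s ρ → state ρ ⊩ atMost 1 (slot s)
  slot-model s ρ = atMost-one M (slot s) (number (ρ s)) λ { _ value → refl }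

  at-slot : ∀ {C ρ} s {n} → ρ s ≡ n → number n ⊩ C → state ρ ⊩ ex (slot s) C
  at-slot {ρ = ρ} s refl h = number (ρ s) , value , h

  upper-model : ∀ b s {ρ n} → parity (suc n) ≡ b → ρ s ≡ suc n → state ρ ⊩ upper b s
  upper-model b s {ρ} {n} par eq = slot-model s ρ ,
    at-slot {and (exactParity b) (and (not zeroᴬ) (ex (link b) top))} s eq
      (exactParity-model b par , (λ { (numeric ()) }) , bond (suc n) , link⁺ b (same par) , tt)

  lower-model : ∀ b s {ρ n} → parity (suc n) ≡ b → ρ s ≡ n → state ρ ⊩ lower b s
  lower-model b s {ρ} {n} par eq = slot-model s ρ ,
    at-slot {and (exactParity (flip b)) (ex (link b) top)} s eq
      (exactParity-model (flip b) (trans (sym (not-involutive (parity n))) (cong flip par)) ,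
       bond (suc n) , link⁺ b (next par) , tt)

  -- Among the bonds of `n` and `suc n`, only `bond (suc n)` has parity `b`. At any bond, the
  -- constructors `same` and `next` give the two classes of linked numbers.
  joined-model : ∀ b s {ρ ρ′ n} → parity (suc n) ≡ b → (∀ {σ} → Edge (join ρ ρ′) (state σ) → σ s ≡ n ⊎ σ s ≡ suc n) →
                 join ρ ρ′ ⊩ joined b s
  joined-model b s {ρ} {ρ′} {n} par values =
    atMost-one M (comp edge (comp (slot s) (link b))) (bond (suc n)) unique ,
    (λ _ _ _ _ l r → atMost-classes M (inv (link b)) 2 class separates)
    where
    bond-of : ∀ {m j} → m ≡ n ⊎ m ≡ suc n → Link b (number m) j → j ≡ bond (suc n)
    bond-of (inj₁ refl) (same par′) = ⊥-elim (not-¬ refl (trans par′ (sym par)))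
    bond-of (inj₁ refl) (next _)    = refl
    bond-of (inj₂ refl) (same _)    = refl
    bond-of (inj₂ refl) (next par′) = ⊥-elim (not-¬ refl (trans par (sym par′)))
    unique : ∀ j → ⟦ M ⟧R (comp edge (comp (slot s) (link b))) (join ρ ρ′) j → j ≡ bond (suc n)
    unique j (state σ , e , _ , value , r) = bond-of (values e) (link⁻ b r)
    class′ : ∀ {i l} → Link b i l → Fin 2
    class′ (same _) = zero
    class′ (next _) = suc zero
    separates′ : ∀ {i j l} (p : Link b i l) (q : Link b j l) → class′ p ≡ class′ q → i ≡ j
    separates′ (same _) (same _) _ = refl
    separates′ (next _) (next _) _ = refl
    class : ∀ {l} i → ⟦ M ⟧R (link b) i l → Fin 2
    class i r = class′ (link⁻ b r)
    separates : ∀ {l} i j (p : ⟦ M ⟧R (link b) i l) (q : ⟦ M ⟧R (link b) j l) → class i p ≡ class j q → i ≡ j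
    separates i j p q = separates′ (link⁻ b p) (link⁻ b q)

  has-model : ∀ {j} (ks : Vec ℕ j) ρ → state ρ ⊩ has ks
  has-model []       ρ = hub , toHub , tt
  has-model (s ∷ ks) ρ = (number (ρ s) , value , tt) , has-model ks ρ

  share-model : ∀ {j ρ ρ′} {ks : Vec ℕ j} → Agree ρ ρ′ ks → join ρ ρ′ ⊩ share ks
  share-model [] = atMost-one M (comp edge centre) hub λ { _ (_ , _ , toHub) → refl }
  share-model {ρ = ρ} {ks = s ∷ _} (eq ∷ agree) =
    atMost-one M (comp edge (slot s)) (number (ρ s)) (λ { _ (_ , first , value) → refl ; _ (_ , second , value) → cong number eq }) ,
    share-model agree

  move-model : ∀ {j ρ ρ′} {ks : Vec ℕ j} A J D X → Agree ρ ρ′ ks →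
               state ρ ⊩ A → join ρ ρ′ ⊩ J → state ρ′ ⊩ D → state ρ′ ⊩ X → state ρ ⊩ fill (moveˣ ks A J D) X
  move-model {ρ = ρ} {ρ′} {ks} A J D X agree a j d x =
    (a , has-model ks ρ) , join ρ ρ′ , first , (j , share-model agree) ,
    state ρ′ , second , (d , has-model ks ρ′) , x

  choose-branch : ∀ {j ρ s} {ks : Vec ℕ j} d b X → state ρ ⊩ fill (branchˣ b d s ks) X → state ρ ⊩ fill (stepˣ d s ks) X
  choose-branch d false X h = inj₁ h
  choose-branch d true  X h = inj₂ h

  step-model : ∀ {j ρ ρ′ s} {ks : Vec ℕ j} d X → Agree ρ ρ′ ks → Steps d (ρ s) (ρ′ s) → state ρ′ ⊩ X →
               state ρ ⊩ fill (stepˣ d s ks) X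
  step-model {ρ = ρ} {ρ′} {s} {ks} up X agree eq x = choose-branch {s = s} {ks} up b X
    (move-model (lower b s) (joined b s) (upper b s) X agree (lower-model b s refl refl)
      (joined-model b s refl λ { first → inj₁ refl ; second → inj₂ eq }) (upper-model b s refl eq) x)
    where b = parity (suc (ρ s))
  step-model {ρ = ρ} {ρ′} {s} {ks} down X agree eq x = choose-branch {s = s} {ks} down b X
    (move-model (upper b s) (joined b s) (lower b s) X agree (upper-model b s refl eq)
      (joined-model b s refl λ { first → inj₂ eq ; second → inj₁ refl }) (lower-model b s refl refl) x)
    where b = parity (suc (ρ′ s))

  derives-model : ∀ {φ ρ} → Derives T φ ρ → state ρ ⊩ ⟨ φ ⟩
  derives-model trivialᵈ = tt
  derives-model {ρ = ρ} (isZeroᵈ {s = s} eq) = (number (ρ s) , value , tt) , λ { _ value → numeric eq }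
  derives-model (isPosᵈ ≢0)   = λ { _ value (numeric eq) → ≢0 eq }
  -- A label holds by its very interpretation as derivability; `table-model` shows that it implies
  -- its formula.
  derives-model δ@(gotoᵈ _)   = marked δ
  derives-model (andᵈ δ δ′)   = derives-model δ , derives-model δ′
  derives-model (leftᵈ δ)     = inj₁ (derives-model δ)
  derives-model (rightᵈ δ)    = inj₂ (derives-model δ)
  derives-model (guessᵈ {φ = φ} ρ′ agree δ) = move-model top top top ⟨ φ ⟩ agree tt tt tt (derives-model δ)
  derives-model (stepᵈ {φ = φ} {d} {s} {ks = ks} ρ′ agree eq δ) = step-model {s = s} {ks} d ⟨ φ ⟩ agree eq (derives-model δ)

  table-model : ∀ {ρ} ℓ φs → At (Completeness.Entry T) ℓ φs → state ρ ⊩ table ℓ φs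
  table-model ℓ []       _           = tt
  table-model ℓ (φ ∷ φs) (refl , at) =
    (λ { (marked (gotoᵈ δ) , ¬φ) → ¬φ (derives-model δ) }) , table-model (suc ℓ) φs at

entry : List Formula → ℕ → Formula
entry []       _       = trivial
entry (φ ∷ φs) zero    = φ
entry (φ ∷ φs) (suc i) = entry φs i

At-entry : ∀ T ℓ φs → (∀ i → T (ℓ + i) ≡ entry φs i) → At (Completeness.Entry T) ℓ φs
At-entry T ℓ []       _ = tt
At-entry T ℓ (φ ∷ φs) h = trans (cong T (sym (+-identityʳ ℓ))) (h 0) ,
  At-entry T (suc ℓ) φs (λ i → trans (cong T (sym (+-suc ℓ i))) (h (suc i)))

inputIs-complete : ∀ T n {ρ} → ρ 0 ≡ n → Derives T (inputIs n) ρ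
inputIs-complete T zero    eq = isZeroᵈ eq
inputIs-complete T (suc n) {ρ} eq =
  stepᵈ (ρ [ 0 ≔ n ]) [] (trans eq (cong suc (sym (update-same ρ 0)))) (inputIs-complete T n (update-same ρ 0))

base-sat : ∀ {L} (e : Code 1) n → Eval e (n ∷ []) 1 → Satisfiable {L} (and (base e) ⟨ inputIs n ⟩)
base-sat {L} e n ev = M , state ρ ,
  ((hub , toHub , λ { _ toHub → table-model 0 φs at }) ,
   derives-model (complete e ev at ((s≤s (s≤s z≤n) ∷ s≤s z≤n ∷ []) , ((λ ()) ∷ []) ∷ [] ∷ []) (refl ∷ []) refl) ,
   derives-model {isPos 1} (isPosᵈ λ ())) ,
  derives-model (inputIs-complete T n refl)
  where
  φs : List Formula
  φs = clauses e (0 ∷ []) 1 2 0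
  T : ℕ → Formula
  T = entry φs
  ρ : Assignment
  -- Register 0 holds the input and register 1 the output; from 2 on, the scratch registers could
  -- start with any value.
  ρ zero    = n
  ρ (suc _) = 1
  open Model L T
  open Completeness T
  at : At Entry 0 φs
  at = At-entry T 0 φs (λ _ → refl)

-- Diagonalisation

iterate : ∀ {L} → Context L → Concept L → ℕ → Concept L
iterate κ C zero    = C
iterate κ C (suc n) = fill κ (iterate κ C n)

iterateᶜ : ∀ {L} → Context L → Concept L → Code 1
-- In the recursion step, the projection `P (suc zero)` is the number of the previous iterate.
iterateᶜ κ C = Rec (constᶜ ⌜ C ⌝) (fillᶜ κ (P (suc zero)))

iterateᶜ-eval : ∀ {L} (κ : Context L) C (D : ℕ → Concept L) → (∀ n → iterate κ C n ≡ D n) →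
                ∀ n → Eval (iterateᶜ κ C) (n ∷ []) ⌜ D n ⌝
iterateᶜ-eval κ C D eq n = subst (λ X → Eval (iterateᶜ κ C) (n ∷ []) ⌜ X ⌝) (eq n) (eval n)
  where
  eval : ∀ n → Eval (iterateᶜ κ C) (n ∷ []) ⌜ iterate κ C n ⌝
  eval zero    = eRec0 (constᶜ-eval ⌜ C ⌝)
  eval (suc n) = eRecS (eval n) (fillᶜ-eval κ (iterate κ C n) (eP (suc zero)))

-- Presenting the input formula as iterated filling of one fixed context makes its number recursive
-- in `n`.
inputIs-iterate : ∀ {L} n → iterate {L} (stepˣ down 0 []) ⟨ isZero 0 ⟩ n ≡ ⟨ inputIs n ⟩
inputIs-iterate zero    = refl
inputIs-iterate (suc n) = cong (fill (stepˣ down 0 [])) (inputIs-iterate n)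

inputᶜ : ∀ L → Σ (Code 1) λ f → ∀ n → Eval f (n ∷ []) ⌜ ⟨_⟩ {L} (inputIs n) ⌝
inputᶜ L = iterateᶜ {L} (stepˣ down 0 []) ⟨ isZero 0 ⟩ ,
  iterateᶜ-eval {L} (stepˣ down 0 []) ⟨ isZero 0 ⟩ (λ n → ⟨ inputIs n ⟩) inputIs-iterate

withInputᶜ : Logic → Code 1
withInputᶜ L = pairᶜ (constᶜ 4) (pairᶜ (P zero) (proj₁ (inputᶜ L)))

withInputᶜ-eval : ∀ {L} (B : Concept L) →
                  Eval (withInputᶜ L) (⌜ B ⌝ ∷ []) ⌜ and B ⟨ inputIs ⌜ B ⌝ ⟩ ⌝
withInputᶜ-eval {L} B = pairᶜ-eval (constᶜ-eval 4) (pairᶜ-eval (eP zero) (proj₂ (inputᶜ L) ⌜ B ⌝))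

negᶜ : Code 1
negᶜ = Rec (constᶜ 1) Z

negᶜ-eval₀ : Eval negᶜ (0 ∷ []) 1
negᶜ-eval₀ = eRec0 (constᶜ-eval 1)

negᶜ-eval₁ : Eval negᶜ (1 ∷ []) 0
negᶜ-eval₁ = eRecS negᶜ-eval₀ eZ

module Diagonal {L : Logic} (B : Code 1 → Concept L) (W : Concept L → Concept L)
  (w : Code 1) (w-eval : ∀ C → Eval w (⌜ C ⌝ ∷ []) ⌜ W C ⌝)
  (unsat : ∀ e → Eval e (⌜ B e ⌝ ∷ []) 0 → ¬ Satisfiable (W (B e)))
  (sat : ∀ e → Eval e (⌜ B e ⌝ ∷ []) 1 → Satisfiable (W (B e))) where

  sat-undecidable : Undecidable (SatProblem L)
  sat-undecidable (c , dec) = C-unsat (sat e (e⇓ (proj₂ (dec ⌜ C ⌝) no-sat)))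
    where
    e : Code 1
    -- On the number of `B e`, this runs `c` on the number of `C` itself.
    e = Comp c (w ∷ [])
    C : Concept L
    C = W (B e)
    e⇓ : ∀ {v} → Eval c (⌜ C ⌝ ∷ []) v → Eval e (⌜ B e ⌝ ∷ []) v
    e⇓ c⇓ = eComp (w-eval (B e) ∷ []) c⇓
    -- If `C` were satisfiable, `c` would answer 0 and `unsat` would apply. Hence `c` answers 1, and
    -- `sat` gives the contradiction.
    C-unsat : ¬ Satisfiable C
    C-unsat s = unsat e (e⇓ (proj₁ (dec ⌜ C ⌝) (C , refl , s))) s
    no-sat : ¬ SatProblem L ⌜ C ⌝
    no-sat (C′ , eq , s) = C-unsat (subst Satisfiable (⌜⌝-injective C′ C eq) s)

  -- Unsatisfiability is subsumption by `bot`, so the diagonal program reverses the answer of `c`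
  -- with `negᶜ`.
  subs-undecidable : Undecidable (SubsProblem L)
  subs-undecidable (c , dec) = C-not-unsat λ s → unsat e (e⇓ (proj₂ (dec q) (no-subs s)) negᶜ-eval₁) s
    where
    e : Code 1
    e = Comp negᶜ (Comp c (pairᶜ w (constᶜ ⌜ bot {L} ⌝) ∷ []) ∷ [])
    C : Concept L
    C = W (B e)
    q : ℕ
    q = pair ⌜ C ⌝ ⌜ bot {L} ⌝
    e⇓ : ∀ {u v} → Eval c (q ∷ []) u → Eval negᶜ (u ∷ []) v → Eval e (⌜ B e ⌝ ∷ []) v
    e⇓ c⇓ neg⇓ = eComp (eComp (pairᶜ-eval (w-eval (B e)) (constᶜ-eval ⌜ bot {L} ⌝) ∷ []) c⇓ ∷ []) neg⇓
    C-not-unsat : ¬ ¬ Satisfiable C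
    C-not-unsat ¬s = ¬s (sat e (e⇓ (proj₁ (dec q) (C , bot , refl , λ I d h → ¬s (I , d , h))) negᶜ-eval₀))
    no-subs : Satisfiable C → ¬ SubsProblem L q
    no-subs (I , d , h) (C′ , D′ , eq , sub) with pair-injective ⌜ C′ ⌝ ⌜ D′ ⌝ ⌜ C ⌝ ⌜ bot {L} ⌝ eq
    ... | eqC , eqD with ⌜⌝-injective C′ C eqC | ⌜⌝-injective D′ bot eqD
    ... | refl | refl = sub I d h

theorem1 : (L : Logic) → Undecidable (SatProblem L) × Undecidable (SubsProblem L)
theorem1 L = sat-undecidable , subs-undecidable
  where
  open Diagonal {L} base (λ C → and C ⟨ inputIs ⌜ C ⌝ ⟩) (withInputᶜ L) withInputᶜ-eval
         (λ e → base-unsat e ⌜ base {L} e ⌝) (λ e → base-sat e ⌜ base {L} e ⌝)
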